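{- Let $G$ be a graph in $\mathcal{G}_2$ that does not contain two distinct $5$-cycles sharing at least one edge. Then $G$ is $3$-colorable.
   Context: All graphs are finite and simple. A hole is an induced cycle of length at least $4$; an odd hole is a hole of odd length. $\mathcal{G}_2$ is the family of graphs of girth exactly $5$ having no odd holes of length at least $7$ (so every $5$-cycle of such a graph is induced). -}

module Defs where

open import Data.Nat using (ℕ; zero; suc; _≤_; _<_)
open import Data.Fin using (Fin; toℕ)
open import Data.Product using (Σ; ∃; _×_; _,_)
open import Data.Sum using (_⊎_)
open import Relation.Nullary using (¬_; Dec)
open import Relation.Binary.PropositionalEquality using (_≡_; _≢_)
open import Function.Definitions using (Injective)
open import Level using (0ℓ)

record Graph (n : ℕ) : Set₁ where
  field
    Adj    : Fin n → Fin n → Set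
    sym    : ∀ {u v} → Adj u v → Adj v u
    irrefl : ∀ {u} → ¬ Adj u u
    dec    : ∀ u v → Dec (Adj u v)
open Graph public

Consec : (k : ℕ) → Fin k → Fin k → Set
Consec k i j = (suc (toℕ i) ≡ toℕ j) ⊎ ((suc (toℕ i) ≡ k) × (toℕ j ≡ 0))

record Cycle {n : ℕ} (G : Graph n) (k : ℕ) : Set where
  field
    len≥3 : 3 ≤ k
    vert  : Fin k → Fin n
    inj   : Injective _≡_ _≡_ vert
    edge  : ∀ i j → Consec k i j → Adj G (vert i) (vert j)
open Cycle public

Induced : ∀ {n} {G : Graph n} {k} → Cycle G k → Set
Induced {G = G} {k} C =
  ∀ i j → Adj G (vert C i) (vert C j) → Consec k i j ⊎ Consec k j i

Hole : ∀ {n} (G : Graph n) (k : ℕ) → Set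
Hole G k = 4 ≤ k × Σ (Cycle G k) Induced

data Odd : ℕ → Set where
  odd1  : Odd 1
  odd+2 : ∀ {m} → Odd m → Odd (suc (suc m))

Girth5 : ∀ {n} → Graph n → Set
Girth5 G = Cycle G 5 × (∀ k → k < 5 → ¬ Cycle G k)

InG₂ : ∀ {n} → Graph n → Set
InG₂ G = Girth5 G × (∀ k → 7 ≤ k → Odd k → ¬ Hole G k)

SamePair : ∀ {n} → Fin n → Fin n → Fin n → Fin n → Set
SamePair u v x y = (u ≡ x × v ≡ y) ⊎ (u ≡ y × v ≡ x)

CycleEdge : ∀ {n} {G : Graph n} {k} → Cycle G k → Fin n → Fin n → Set
CycleEdge {k = k} C u v = ∃ λ i → ∃ λ j → Consec k i j × SamePair (vert C i) (vert C j) u v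

-- Two 5-cycles are distinct (as subgraphs) if some edge of one is not an edge of the other.
Distinct5 : ∀ {n} {G : Graph n} → Cycle G 5 → Cycle G 5 → Set
Distinct5 C D =
  (∃ λ u → ∃ λ v → CycleEdge C u v × ¬ CycleEdge D u v)
  ⊎ (∃ λ u → ∃ λ v → CycleEdge D u v × ¬ CycleEdge C u v)

ShareEdge : ∀ {n} {G : Graph n} {k l} → Cycle G k → Cycle G l → Set
ShareEdge C D = ∃ λ u → ∃ λ v → CycleEdge C u v × CycleEdge D u v

ThreeColorable : ∀ {n} → Graph n → Set
ThreeColorable {n} G = Σ (Fin n → Fin 3) λ f → ∀ u v → Adj G u v → f u ≢ f v

-- Let C = abcde be a 5-cycle. By girth 5 and edge-disjointness, a vertex off C has at most one neighbour
-- on C and no two neighbours of C are adjacent. An induced path off C closes up along an arc of C to a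
-- hole, which is even or a 5-cycle, so the parity of the path is determined by the vertices of C to which
-- its ends and interior attach. Comparing these parities shows that every component K of G ∖ C attaches to
-- at most three consecutive vertices a, b, c of C, so that {a, b, c} separates K from d and e.
--
-- The two sides have 3-colourings by induction; let b have colour 0 and a colour 1 in both. If they disagree
-- on c, swap the colours 1 and 2 on the Kempe component of c on one side. This fails only if both Kempe
-- components contain a; then two Kempe chains form an odd closed walk, which yields a 5-cycle avoiding b
-- and containing a and c, hence a 4-cycle with b. A graph without 5-cycles has no odd closed walk at all
-- and is bipartite.
--
-- 3-colourability of a finite graph is decidable, so the argument may be carried out under ¬ ¬.

module Submission where

open import Defs
open import Data.Nat using (ℕ)
open import Data.Product using (_×_)
open import Relation.Nullary using (¬_)

open import Data.Bool using (true; false; if_then_else_)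
open import Data.Empty using (⊥; ⊥-elim)
open import Data.Fin using (Fin; toℕ; finToFun; funToFin)
open import Data.Fin.Patterns using (0F; 1F; 2F)
open import Data.Fin.Properties using (toℕ<n; toℕ-injective; _≟_; any?; all?; sequence; finToFun-funToFin)
open import Data.Fin.Subset using (Subset; _∈_; _⊂_; ⊤)
open import Data.Fin.Subset.Induction using (⊂-wellFounded)
open import Data.Fin.Subset.Properties using (_∈?_; ∈⊤)
open import Data.Nat using (zero; suc; _+_; _∸_; _^_; _≤_; _<_; z≤n; s≤s; s≤s⁻¹; z<s; s<s; parity)
open import Data.Nat.Induction using (<-rec)
open import Data.Nat.Properties hiding (_≟_)
open import Data.Parity as ℙ using (Parity; 0ℙ; 1ℙ; _⁻¹)
open import Data.Parity.Properties as ℙₚ using (⁻¹-injective; ⁻¹-involutive; +-homo-+; p≢p⁻¹)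
open import Data.Product using (∃; ∃₂; _,_; proj₁; proj₂)
open import Data.Sum using (_⊎_; inj₁; inj₂)
open import Data.Vec using (tabulate)
open import Data.Vec.Properties using (lookup∘tabulate; lookup⇒[]=; []=⇒lookup)
open import Effect.Monad using (RawMonad)
open import Function using (case_of_; _∘_)
open import Induction.WellFounded using (Acc; acc)
open import Relation.Binary.Definitions using (tri<; tri≈; tri>)
open import Relation.Binary.PropositionalEquality using (_≡_; _≢_; refl; trans; cong; cong₂; subst; subst₂; ≢-sym; module ≡-Reasoning) renaming (sym to ≡-sym)
open import Relation.Nullary using (Dec; yes; no; does)
open import Relation.Nullary.Decidable using (_⊎-dec_; _×-dec_; _→-dec_; ¬?; map′; ¬¬-excluded-middle; decidable-stable; dec-true; dec-false)
open import Relation.Nullary.Negation using (¬¬-Monad)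
open import Relation.Unary using (Decidable)

-- Parities of lengths, and of a walk cut at two positions.

parity⇒Odd : ∀ k → parity k ≡ 1ℙ → Odd k
parity⇒Odd 1             e = odd1
parity⇒Odd (suc (suc k)) e = odd+2 (parity⇒Odd k e)

parity-suc : ∀ k → parity (suc k) ≡ parity k ⁻¹
parity-suc k = +-homo-+ 1 k

even⇒suc-odd : ∀ k → parity k ≡ 0ℙ → parity (suc k) ≡ 1ℙ
even⇒suc-odd k even = trans (parity-suc k) (cong _⁻¹ even)

parity-∸ : ∀ {s t} → s ≤ t → parity t ≡ parity (t ∸ s) ℙ.+ parity s
parity-∸ {s} {t} s≤t = trans (cong parity (≡-sym (m∸n+n≡m s≤t))) (+-homo-+ (t ∸ s) s)

parity-splice : ∀ {i j l} → i ≤ j → j ≤ l → parity l ≡ parity (i + (l ∸ j)) ℙ.+ parity (j ∸ i)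
parity-splice {i} {j} {l} i≤j j≤l = trans (cong parity lengths) (+-homo-+ (i + (l ∸ j)) (j ∸ i))
  where
  open ≡-Reasoning
  lengths : l ≡ i + (l ∸ j) + (j ∸ i)
  lengths = begin
    l                         ≡⟨ m+[n∸m]≡n j≤l ⟨
    j + (l ∸ j)               ≡⟨ cong (_+ (l ∸ j)) (m+[n∸m]≡n i≤j) ⟨
    i + (j ∸ i) + (l ∸ j)     ≡⟨ +-assoc i (j ∸ i) (l ∸ j) ⟩
    i + ((j ∸ i) + (l ∸ j))   ≡⟨ cong (i +_) (+-comm (j ∸ i) (l ∸ j)) ⟩
    i + ((l ∸ j) + (j ∸ i))   ≡⟨ +-assoc i (l ∸ j) (j ∸ i) ⟨
    i + (l ∸ j) + (j ∸ i)     ∎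

contract-shorter : ∀ {i j l} → i < j → j ≤ l → i + (l ∸ j) < l
contract-shorter {i} {j} {l} i<j j≤l = subst (i + (l ∸ j) <_) (m+[n∸m]≡n j≤l) (+-monoˡ-< (l ∸ j) i<j)

shortcut-shorter : ∀ {i j l} → suc i < j → j ≤ l → i + suc (l ∸ j) < l
shortcut-shorter {i} {j} {l} i<j j≤l = subst (_< l) (≡-sym (+-suc i (l ∸ j))) (contract-shorter i<j j≤l)

-- Bounded search for positions on a path.

module _ {P : ℕ → Set} (P? : Decidable P) where

  last-before : ∀ i → (∃ λ j → j < i × P j × (∀ {k} → j < k → k < i → ¬ P k)) ⊎ (∀ {k} → k < i → ¬ P k)
  last-before zero = inj₂ λ ()
  last-before (suc i) with P? i
  ... | yes Pi = inj₁ (i , ≤-refl , Pi , λ i<k k≤i → ⊥-elim (<⇒≱ i<k (s≤s⁻¹ k≤i)))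
  ... | no ¬Pi with last-before i
  ... | inj₁ (j , j<i , Pj , none) = inj₁ (j , m<n⇒m<1+n j<i , Pj , λ j<k k≤i → extend (none j<k) k≤i)
    where
    extend : ∀ {k} → (k < i → ¬ P k) → k < suc i → ¬ P k
    extend f k≤i with m≤n⇒m<n∨m≡n (s≤s⁻¹ k≤i)
    ... | inj₁ k<i  = f k<i
    ... | inj₂ refl = ¬Pi
  ... | inj₂ none = inj₂ extend
    where
    extend : ∀ {k} → k < suc i → ¬ P k
    extend k≤i with m≤n⇒m<n∨m≡n (s≤s⁻¹ k≤i)
    ... | inj₁ k<i  = none k<i
    ... | inj₂ refl = ¬Pi

  first-after : ∀ i t → (∃ λ j → i < j × j < t × P j × (∀ {k} → i < k → k < j → ¬ P k)) ⊎
    (∀ {k} → i < k → k < t → ¬ P k)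
  first-after i zero = inj₂ λ _ ()
  first-after i (suc t) with first-after i t
  ... | inj₁ (j , i<j , j<t , found) = inj₁ (j , i<j , m<n⇒m<1+n j<t , found)
  ... | inj₂ none with P? t | i <? t
  ... | yes Pt | yes i<t = inj₁ (t , i<t , ≤-refl , Pt , none)
  ... | yes Pt | no  i≮t = inj₂ λ i<k k≤t → ⊥-elim (i≮t (<-≤-trans i<k (s≤s⁻¹ k≤t)))
  ... | no ¬Pt | _       = inj₂ extend
    where
    extend : ∀ {k} → i < k → k < suc t → ¬ P k
    extend i<k k≤t with m≤n⇒m<n∨m≡n (s≤s⁻¹ k≤t)
    ... | inj₁ k<t  = none i<k k<t
    ... | inj₂ refl = ¬Pt

-- Decidable subsets, and excluded middle under double negation.

subset : ∀ {n} {T : Fin n → Set} → Decidable T → Subset n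
subset T? = tabulate (λ x → does (T? x))

∈-subset⁺ : ∀ {n} {T : Fin n → Set} (T? : Decidable T) {x} → T x → x ∈ subset T?
∈-subset⁺ T? {x} Tx = lookup⇒[]= x _ (trans (lookup∘tabulate (λ x → does (T? x)) x) (dec-true (T? x) Tx))

∈-subset⁻ : ∀ {n} {T : Fin n → Set} (T? : Decidable T) {x} → x ∈ subset T? → T x
∈-subset⁻ T? {x} x∈ with T? x in eq
... | yes Tx = Tx
... | no _ = case trans (≡-sym ([]=⇒lookup x∈)) (trans (lookup∘tabulate (λ x → does (T? x)) x) (cong does eq)) of λ ()

-- Finitely many instances of excluded middle combine under `¬ ¬`. This gives decisions on
-- reachability without a search through walks.
¬¬-decidable : ∀ {n} (P : Fin n → Set) → ¬ ¬ Decidable P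
¬¬-decidable P = sequence (RawMonad.rawApplicative ¬¬-Monad) (λ _ → ¬¬-excluded-middle)

-- Permutations of the three colours.

relabel : Fin 3 → Fin 3 → Fin 3 → Fin 3 → Fin 3
relabel x y z 0F = x
relabel x y z 1F = y
relabel x y z 2F = z

relabel-injective : ∀ {x y z} → x ≢ y → y ≢ z → x ≢ z → ∀ {i j} → i ≢ j → relabel x y z i ≢ relabel x y z j
relabel-injective x≢y y≢z x≢z {0F} {0F} i≢j = ⊥-elim (i≢j refl)
relabel-injective x≢y y≢z x≢z {0F} {1F} i≢j = x≢y
relabel-injective x≢y y≢z x≢z {0F} {2F} i≢j = x≢z
relabel-injective x≢y y≢z x≢z {1F} {0F} i≢j = ≢-sym x≢y
relabel-injective x≢y y≢z x≢z {1F} {1F} i≢j = ⊥-elim (i≢j refl)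
relabel-injective x≢y y≢z x≢z {1F} {2F} i≢j = y≢z
relabel-injective x≢y y≢z x≢z {2F} {0F} i≢j = ≢-sym x≢z
relabel-injective x≢y y≢z x≢z {2F} {1F} i≢j = ≢-sym y≢z
relabel-injective x≢y y≢z x≢z {2F} {2F} i≢j = ⊥-elim (i≢j refl)

-- Serves to make two colourings agree on the ends of an edge before they are glued.
normalise : ∀ x y → x ≢ y → ∃ λ (π : Fin 3 → Fin 3) → (∀ {i j} → i ≢ j → π i ≢ π j) × π x ≡ 0F × π y ≡ 1F
normalise 0F 0F x≢y = ⊥-elim (x≢y refl)
normalise 0F 1F _   = relabel 0F 1F 2F , relabel-injective (λ ()) (λ ()) (λ ()) , refl , refl
normalise 0F 2F _   = relabel 0F 2F 1F , relabel-injective (λ ()) (λ ()) (λ ()) , refl , refl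
normalise 1F 0F _   = relabel 1F 0F 2F , relabel-injective (λ ()) (λ ()) (λ ()) , refl , refl
normalise 1F 1F x≢y = ⊥-elim (x≢y refl)
normalise 1F 2F _   = relabel 2F 0F 1F , relabel-injective (λ ()) (λ ()) (λ ()) , refl , refl
normalise 2F 0F _   = relabel 1F 2F 0F , relabel-injective (λ ()) (λ ()) (λ ()) , refl , refl
normalise 2F 1F _   = relabel 2F 1F 0F , relabel-injective (λ ()) (λ ()) (λ ()) , refl , refl
normalise 2F 2F x≢y = ⊥-elim (x≢y refl)

swap : Fin 3 → Fin 3
swap = relabel 0F 2F 1F

swap-injective : ∀ {i j} → i ≢ j → swap i ≢ swap j
swap-injective = relabel-injective (λ ()) (λ ()) (λ ())

swap-other : ∀ {i j} → i ≢ 0F → j ≢ 0F → i ≢ j → swap i ≡ j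
swap-other {0F} i≢0 _ _ = ⊥-elim (i≢0 refl)
swap-other {1F} {0F} _ j≢0 _ = ⊥-elim (j≢0 refl)
swap-other {1F} {1F} _ _ i≢j = ⊥-elim (i≢j refl)
swap-other {1F} {2F} _ _ _ = refl
swap-other {2F} {0F} _ j≢0 _ = ⊥-elim (j≢0 refl)
swap-other {2F} {1F} _ _ _ = refl
swap-other {2F} {2F} _ _ i≢j = ⊥-elim (i≢j refl)

-- The value at 0F is junk: side is only applied to the two Kempe colours 1F and 2F.
side : Fin 3 → Parity
side 0F = 0ℙ
side 1F = 0ℙ
side 2F = 1ℙ

side-other : ∀ {i j} → i ≢ 0F → j ≢ 0F → i ≢ j → side j ≡ side i ⁻¹
side-other {0F} i≢0 _ _ = ⊥-elim (i≢0 refl)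
side-other {1F} {0F} _ j≢0 _ = ⊥-elim (j≢0 refl)
side-other {1F} {1F} _ _ i≢j = ⊥-elim (i≢j refl)
side-other {1F} {2F} _ _ _ = refl
side-other {2F} {0F} _ j≢0 _ = ⊥-elim (j≢0 refl)
side-other {2F} {1F} _ _ _ = refl
side-other {2F} {2F} _ _ i≢j = ⊥-elim (i≢j refl)

-- Rings, induced paths and holes.

infixr 5 _◂_
_◂_ : ∀ {A : Set} → A → (ℕ → A) → ℕ → A
(x ◂ w) zero    = x
(x ◂ w) (suc i) = w i

module InGraph {n : ℕ} (G : Graph n) where

  infix 4 _~_
  _~_ : Fin n → Fin n → Set
  _~_ = Adj G

  ~-sym : ∀ {u v} → u ~ v → v ~ u
  ~-sym = Graph.sym G

  ~⇒≢ : ∀ {u v} → u ~ v → u ≢ v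
  ~⇒≢ u~u refl = irrefl G u~u

  -- Here and in InducedPath the vertices are w 0, …, w p, so that a ring has length p + 1 and a path has
  -- length p; later values of w are junk.
  record Ring (w : ℕ → Fin n) (p : ℕ) : Set where
    field
      step     : ∀ {i} → i < p → w i ~ w (suc i)
      close    : w p ~ w 0
      distinct : ∀ {i j} → i < j → j ≤ p → w i ≢ w j

  record InducedPath (w : ℕ → Fin n) (p : ℕ) : Set where
    field
      step      : ∀ {i} → i < p → w i ~ w (suc i)
      distinct  : ∀ {i j} → i < j → j ≤ p → w i ≢ w j
      chordless : ∀ {i j} → suc i < j → j ≤ p → ¬ w i ~ w j

  consec-elim : ∀ (w : ℕ → Fin n) {p} (Q : Fin n → Fin n → Set) → (∀ {i} → i < p → Q (w i) (w (suc i))) → Q (w p) (w 0) →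
    ∀ (i j : Fin (suc p)) → Consec (suc p) i j → Q (w (toℕ i)) (w (toℕ j))
  consec-elim w {p} Q s c i j (inj₁ e) =
    subst (λ k → Q (w (toℕ i)) (w k)) e (s (subst (_≤ p) (≡-sym e) (s≤s⁻¹ (toℕ<n j))))
  consec-elim w Q s c i j (inj₂ (e , f)) =
    subst₂ (λ k l → Q (w k) (w l)) (≡-sym (suc-injective e)) (≡-sym f) c

  ring⇒cycle : ∀ {w p} → 2 ≤ p → Ring w p → Cycle G (suc p)
  ring⇒cycle {w} {p} 2≤p R = record
    { len≥3 = s≤s 2≤p
    ; vert  = λ i → w (toℕ i)
    ; inj   = λ {i} {j} e → toℕ-injective (injective i j e)
    ; edge  = consec-elim w _~_ (Ring.step R) (Ring.close R)
    }
    where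
    injective : ∀ (i j : Fin (suc p)) → w (toℕ i) ≡ w (toℕ j) → toℕ i ≡ toℕ j
    injective i j e with <-cmp (toℕ i) (toℕ j)
    ... | tri< i<j _ _ = ⊥-elim (Ring.distinct R i<j (s≤s⁻¹ (toℕ<n j)) e)
    ... | tri≈ _ i≡j _ = i≡j
    ... | tri> _ _ j<i = ⊥-elim (Ring.distinct R j<i (s≤s⁻¹ (toℕ<n i)) (≡-sym e))

  -- By symmetry chords are tested only for `i < j`; the one pair allowed, `0` and `p`, is the
  -- closing edge, which `Consec` counts as its wrap-around case.
  ring⇒hole : ∀ {w p} → 3 ≤ p → Ring w p →
    (∀ {i j} → suc i < j → j ≤ p → w i ~ w j → i ≡ 0 × j ≡ p) → Hole G (suc p)
  ring⇒hole {w} {p} 3≤p R chord = s≤s 3≤p , ring⇒cycle (≤-trans (n≤1+n 2) 3≤p) R , induced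
    where
    ordered : ∀ (i j : Fin (suc p)) → toℕ i < toℕ j → w (toℕ i) ~ w (toℕ j) →
      Consec (suc p) i j ⊎ Consec (suc p) j i
    ordered i j i<j a with m≤n⇒m<n∨m≡n i<j
    ... | inj₂ e = inj₁ (inj₁ e)
    ... | inj₁ l with chord l (s≤s⁻¹ (toℕ<n j)) a
    ... | e , f = inj₂ (inj₂ (cong suc f , e))
    induced : ∀ (i j : Fin (suc p)) → w (toℕ i) ~ w (toℕ j) → Consec (suc p) i j ⊎ Consec (suc p) j i
    induced i j a with <-cmp (toℕ i) (toℕ j)
    ... | tri< i<j _ _ = ordered i j i<j a
    ... | tri≈ _ i≡j _ = ⊥-elim (~⇒≢ a (cong w i≡j))
    ... | tri> _ _ j<i with ordered j i j<i (~-sym a)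
    ... | inj₁ c = inj₂ c
    ... | inj₂ c = inj₁ c

  segment : ∀ {w p s t} → InducedPath w p → s ≤ t → t ≤ p → InducedPath (λ i → w (s + i)) (t ∸ s)
  segment {w} {p} {s} {t} P s≤t t≤p = record
    { step      = λ {i} i<q → subst (λ k → w (s + i) ~ w k) (≡-sym (+-suc s i))
                    (InducedPath.step P (<-≤-trans (+-monoʳ-< s i<q) s+q≤p))
    ; distinct  = λ i<j j≤q → InducedPath.distinct P (+-monoʳ-< s i<j) (≤-trans (+-monoʳ-≤ s j≤q) s+q≤p)
    ; chordless = λ {i} {j} i<j j≤q → InducedPath.chordless P
                    (subst (_< s + j) (+-suc s i) (+-monoʳ-< s i<j)) (≤-trans (+-monoʳ-≤ s j≤q) s+q≤p)
    }
    where
    s+q≤p : s + (t ∸ s) ≤ p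
    s+q≤p = subst (_≤ p) (≡-sym (m+[n∸m]≡n s≤t)) t≤p

  ◂-step : ∀ {w p x} → InducedPath w p → x ~ w 0 → ∀ {i} → i < suc p → (x ◂ w) i ~ (x ◂ w) (suc i)
  ◂-step P x~w₀ {zero}  _ = x~w₀
  ◂-step P x~w₀ {suc i} l = InducedPath.step P (s≤s⁻¹ l)

  ◂-distinct : ∀ {w p x} → InducedPath w p → (∀ {j} → j ≤ p → x ≢ w j) →
    ∀ {i j} → i < j → j ≤ suc p → (x ◂ w) i ≢ (x ◂ w) j
  ◂-distinct P new {zero}  {suc j} _ l = new (s≤s⁻¹ l)
  ◂-distinct P new {suc i} {suc j} k l = InducedPath.distinct P (s≤s⁻¹ k) (s≤s⁻¹ l)

  cons-path : ∀ {w p x} → InducedPath w p → x ~ w 0 → (∀ {j} → 0 < j → j ≤ p → ¬ x ~ w j) →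
    (∀ {j} → j ≤ p → x ≢ w j) → InducedPath (x ◂ w) (suc p)
  cons-path {w} {p} {x} P x~w₀ far new = record
    { step = ◂-step P x~w₀ ; distinct = ◂-distinct P new ; chordless = chordless }
    where
    chordless : ∀ {i j} → suc i < j → j ≤ suc p → ¬ (x ◂ w) i ~ (x ◂ w) j
    chordless {zero}  {suc j} k l = far (s≤s⁻¹ k) (s≤s⁻¹ l)
    chordless {suc i} {suc j} k l = InducedPath.chordless P (s≤s⁻¹ k) (s≤s⁻¹ l)

  close-path : ∀ {w p x} → InducedPath w p → 2 ≤ p → x ~ w 0 → x ~ w p →
    (∀ {j} → 0 < j → j < p → ¬ x ~ w j) → (∀ {j} → j ≤ p → x ≢ w j) → Hole G (2 + p)
  close-path {w} {p} {x} P 2≤p x~w₀ x~wₚ far new = ring⇒hole (s≤s 2≤p)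
    (record { step = ◂-step P x~w₀ ; close = ~-sym x~wₚ ; distinct = ◂-distinct P new }) chord
    where
    chord : ∀ {i j} → suc i < j → j ≤ suc p → (x ◂ w) i ~ (x ◂ w) j → i ≡ 0 × j ≡ suc p
    chord {zero}  {suc j} k l a with m≤n⇒m<n∨m≡n (s≤s⁻¹ l)
    ... | inj₁ j<p = ⊥-elim (far (s≤s⁻¹ k) j<p a)
    ... | inj₂ j≡p = refl , cong suc j≡p
    chord {suc i} {suc j} k l a = ⊥-elim (InducedPath.chordless P (s≤s⁻¹ k) (s≤s⁻¹ l) a)

  -- Walks inside a given set of vertices.

  infixr 5 _⟨_⟩_
  data Walk (P : Fin n → Set) : Fin n → Fin n → ℕ → Set where
    [_]   : ∀ {u} → P u → Walk P u u 0
    _⟨_⟩_ : ∀ {u v w l} → P u → u ~ v → Walk P v w l → Walk P u w (suc l)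

  module _ {P : Fin n → Set} where

    start : ∀ {u v l} → Walk P u v l → P u
    start [ Pu ]       = Pu
    start (Pu ⟨ _ ⟩ _) = Pu

    infixr 5 _++_
    _++_ : ∀ {u v w l m} → Walk P u v l → Walk P v w m → Walk P u w (l + m)
    [ _ ]        ++ Y = Y
    (p ⟨ e ⟩ X)  ++ Y = p ⟨ e ⟩ (X ++ Y)

    snoc : ∀ {u v w l} → Walk P u v l → v ~ w → P w → Walk P u w (suc l)
    snoc [ p ]       e q = p ⟨ e ⟩ [ q ]
    snoc (p ⟨ f ⟩ X) e q = p ⟨ f ⟩ snoc X e q

    reverse : ∀ {u v l} → Walk P u v l → Walk P v u l
    reverse [ p ]       = [ p ]
    reverse (p ⟨ e ⟩ X) = snoc (reverse X) (~-sym e) p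

    end : ∀ {u v l} → Walk P u v l → P v
    end X = start (reverse X)

    -- Constant from index l on.
    at : ∀ {u v l} → Walk P u v l → ℕ → Fin n
    at {u} [ _ ]       _       = u
    at {u} (_ ⟨ _ ⟩ _) zero    = u
    at     (_ ⟨ _ ⟩ X) (suc i) = at X i

    at-0 : ∀ {u v l} (X : Walk P u v l) → at X 0 ≡ u
    at-0 [ _ ]       = refl
    at-0 (_ ⟨ _ ⟩ _) = refl

    at-end : ∀ {u v l} (X : Walk P u v l) → at X l ≡ v
    at-end [ _ ]       = refl
    at-end (_ ⟨ _ ⟩ X) = at-end X

    at-P : ∀ {u v l} (X : Walk P u v l) i → P (at X i)
    at-P [ p ]       _       = p
    at-P (p ⟨ _ ⟩ _) zero    = p
    at-P (_ ⟨ _ ⟩ X) (suc i) = at-P X i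

    at-step : ∀ {u v l} (X : Walk P u v l) {i} → i < l → at X i ~ at X (suc i)
    at-step (_ ⟨ e ⟩ X) {zero}  _ = subst (_ ~_) (≡-sym (at-0 X)) e
    at-step (_ ⟨ _ ⟩ X) {suc i} l = at-step X (s≤s⁻¹ l)

    take : ∀ {u v l} (X : Walk P u v l) {i} → i ≤ l → Walk P u (at X i) i
    take [ p ]       {zero}  _ = [ p ]
    take (p ⟨ _ ⟩ _) {zero}  _ = [ p ]
    take (p ⟨ e ⟩ X) {suc i} l = p ⟨ e ⟩ take X (s≤s⁻¹ l)

    drop : ∀ {u v l} (X : Walk P u v l) {i} → i ≤ l → Walk P (at X i) v (l ∸ i)
    drop [ p ]       {zero}  _ = [ p ]
    drop (p ⟨ e ⟩ X) {zero}  _ = p ⟨ e ⟩ X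
    drop (_ ⟨ _ ⟩ X) {suc i} l = drop X (s≤s⁻¹ l)

    slice : ∀ {u v l} (X : Walk P u v l) {i j} → i ≤ j → j ≤ l → Walk P (at X i) (at X j) (j ∸ i)
    slice X           {zero}  {j}     _   j≤l = subst (λ x → Walk P x (at X j) j) (≡-sym (at-0 X)) (take X j≤l)
    slice (_ ⟨ _ ⟩ X) {suc i} {suc j} i≤j j≤l = slice X (s≤s⁻¹ i≤j) (s≤s⁻¹ j≤l)

    contract : ∀ {u v l} (X : Walk P u v l) {i j} → i < j → j ≤ l → at X i ≡ at X j → Walk P u v (i + (l ∸ j))
    contract X i<j j≤l eq = take X (≤-trans (<⇒≤ i<j) j≤l) ++ subst (λ x → Walk P x _ _) (≡-sym eq) (drop X j≤l)

    shortcut : ∀ {u v l} (X : Walk P u v l) {i j} → i < j → j ≤ l → at X i ~ at X j → Walk P u v (i + suc (l ∸ j))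
    shortcut X i<j j≤l e = take X (≤-trans (<⇒≤ i<j) j≤l) ++ (at-P X _ ⟨ e ⟩ drop X j≤l)

    restrict : ∀ {Q : Fin n → Set} {u v l} (X : Walk P u v l) → (∀ {i} → i ≤ l → Q (at X i)) → Walk Q u v l
    restrict [ _ ]       q = [ q z≤n ]
    restrict (_ ⟨ e ⟩ X) q = q z≤n ⟨ e ⟩ restrict X (λ l → q (s≤s l))

  map : ∀ {P Q : Fin n → Set} → (∀ {x} → P x → Q x) → ∀ {u v l} → Walk P u v l → Walk Q u v l
  map f [ p ]       = [ f p ]
  map f (p ⟨ e ⟩ X) = f p ⟨ e ⟩ map f X

  -- Stop at the first vertex with `Q`. The condition `Q x → x ≡ z` on each vertex records this
  -- without positions, so it survives reversal and concatenation.
  first-hit : ∀ {P Q : Fin n → Set} → Decidable Q → ∀ {u v l} → Walk P u v l → Q v →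
    ∃₂ λ z m → Q z × Walk (λ x → P x × (Q x → x ≡ z)) u z m
  first-hit Q? [ p ] q = _ , 0 , q , [ p , (λ _ → refl) ]
  first-hit Q? {u} (p ⟨ e ⟩ X) q with Q? u | first-hit Q? X q
  ... | yes Qu | _ = u , 0 , Qu , [ p , (λ _ → refl) ]
  ... | no ¬Qu | z , m , Qz , Y = z , suc m , Qz , (p , (λ Qu → ⊥-elim (¬Qu Qu))) ⟨ e ⟩ Y

  -- Colourings of subsets, two-colourings by parity, and Kempe swaps.

  Proper : (Fin n → Set) → (Fin n → Fin 3) → Set
  Proper S f = ∀ {u v} → S u → S v → u ~ v → f u ≢ f v

  Colourable : (Fin n → Set) → Set
  Colourable S = ∃ (Proper S)

  Reach : (Fin n → Set) → Fin n → Fin n → Set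
  Reach P u v = ∃ (Walk P u v)

  module _ {K : Fin n → Set} (K? : Decidable K) (f g : Fin n → Fin 3) where

    merge : Fin n → Fin 3
    merge x = if does (K? x) then f x else g x

    merge-in : ∀ {x} → K x → merge x ≡ f x
    merge-in {x} Kx = cong (if_then f x else g x) (dec-true (K? x) Kx)

    merge-out : ∀ {x} → ¬ K x → merge x ≡ g x
    merge-out {x} ¬Kx = cong (if_then f x else g x) (dec-false (K? x) ¬Kx)

    merge-proper : ∀ {T} → Proper (λ x → T x × K x) f → Proper (λ x → T x × ¬ K x) g →
      (∀ {u v} → T u → T v → K u → ¬ K v → u ~ v → f u ≢ g v) → Proper T merge
    merge-proper pf pg across {u} {v} Tu Tv e with K? u | K? v
    ... | yes Ku | yes Kv = pf (Tu , Ku) (Tv , Kv) e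
    ... | yes Ku | no ¬Kv = across Tu Tv Ku ¬Kv e
    ... | no ¬Ku | yes Kv = ≢-sym (across Tv Tu Kv ¬Ku (~-sym e))
    ... | no ¬Ku | no ¬Kv = pg (Tu , ¬Ku) (Tv , ¬Kv) e

  -- A proper two-colouring with parities as colours, so that colours can be added to lengths of
  -- walks.
  Alternating : (Fin n → Set) → (Fin n → Parity) → Set
  Alternating P χ = ∀ {u v} → P u → P v → u ~ v → χ v ≡ χ u ⁻¹

  proper⇒alternating : ∀ {P f} → Proper P f → (∀ {x} → P x → f x ≢ 0F) → Alternating P (side ∘ f)
  proper⇒alternating pf nz Pu Pv e = side-other (nz Pu) (nz Pv) (pf Pu Pv e)

  walk-parity : ∀ {P χ} → Alternating P χ → ∀ {u v l} → Walk P u v l → χ v ≡ parity l ℙ.+ χ u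
  walk-parity alt [ _ ] = refl
  walk-parity {χ = χ} alt {u} (_⟨_⟩_ {v = v} {l = l} p e X) = begin
    χ _                       ≡⟨ walk-parity alt X ⟩
    parity l ℙ.+ χ v          ≡⟨ cong (parity l ℙ.+_) (alt p (start X) e) ⟩
    parity l ℙ.+ (χ u ⁻¹)     ≡⟨ ℙₚ.+-assoc (parity l) 1ℙ (χ u) ⟨
    parity l ℙ.+ 1ℙ ℙ.+ χ u   ≡⟨ cong (ℙ._+ χ u) (ℙₚ.+-comm (parity l) 1ℙ) ⟩
    parity l ⁻¹ ℙ.+ χ u       ≡⟨ cong (ℙ._+ χ u) (parity-suc l) ⟨
    parity (suc l) ℙ.+ χ u    ∎
    where open ≡-Reasoning

  module KempeSwap {T : Fin n → Set} {f : Fin n → Fin 3} (pf : Proper T f) (c : Fin n)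
    (W? : Decidable (Reach (λ x → T x × f x ≢ 0F) c)) where

    kempe-swap : Fin n → Fin 3
    kempe-swap = merge W? (swap ∘ f) f

    -- An edge leaving the Kempe component ends in colour `0F`, since otherwise the component would
    -- contain its far end; and `swap` sends no other colour to `0F`.
    kempe-proper : Proper T kempe-swap
    kempe-proper = merge-proper W? (swap ∘ f) f
      (λ (Tu , _) (Tv , _) e → swap-injective (pf Tu Tv e))
      (λ (Tu , _) (Tv , _) e → pf Tu Tv e)
      λ {u} {v} Tu Tv (_ , X) ¬Wv e eq → case f v ≟ 0F of λ
        { (no fv≢0)  → ¬Wv (_ , snoc X e (Tv , fv≢0))
        ; (yes fv≡0) → swap-injective (proj₂ (end X)) (trans eq fv≡0) }

-- Short cycles, odd holes and pentagons under the hypotheses of the theorem.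

module EdgeDisjointPentagons {n : ℕ} (G : Graph n) (G∈G₂ : InG₂ G)
  (edge-disjoint : ∀ (C D : Cycle G 5) → ¬ (Distinct5 C D × ShareEdge C D)) where

  open InGraph G

  no-triangle : ∀ {a b c} → a ~ b → b ~ c → c ~ a → ⊥
  no-triangle {a} {b} {c} ab bc ca = proj₂ (proj₁ G∈G₂) 3 (s≤s (s≤s (s≤s (s≤s z≤n))))
    (ring⇒cycle (s≤s (s≤s z≤n)) (record { step = step ; close = ca ; distinct = distinct }))
    where
    w : ℕ → Fin n
    w = a ◂ b ◂ λ _ → c
    step : ∀ {i} → i < 2 → w i ~ w (suc i)
    step {0} _ = ab
    step {1} _ = bc
    step {suc (suc _)} (s≤s (s≤s ()))
    distinct : ∀ {i j} → i < j → j ≤ 2 → w i ≢ w j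
    distinct {0} {1} _ _ = ~⇒≢ ab
    distinct {0} {2} _ _ = ≢-sym (~⇒≢ ca)
    distinct {1} {2} _ _ = ~⇒≢ bc
    distinct {suc _} {1} (s≤s ())
    distinct {suc (suc _)} {2} (s≤s (s≤s ()))
    distinct {_} {suc (suc (suc _))} _ (s≤s (s≤s ()))

  no-square : ∀ {a b c d} → a ~ b → b ~ c → c ~ d → d ~ a → a ≢ c → b ≢ d → ⊥
  no-square {a} {b} {c} {d} ab bc cd da a≢c b≢d = proj₂ (proj₁ G∈G₂) 4 (s≤s (s≤s (s≤s (s≤s (s≤s z≤n)))))
    (ring⇒cycle (s≤s (s≤s z≤n)) (record { step = step ; close = da ; distinct = distinct }))
    where
    w : ℕ → Fin n
    w = a ◂ b ◂ c ◂ λ _ → d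
    step : ∀ {i} → i < 3 → w i ~ w (suc i)
    step {0} _ = ab
    step {1} _ = bc
    step {2} _ = cd
    step {suc (suc (suc _))} (s≤s (s≤s (s≤s ())))
    distinct : ∀ {i j} → i < j → j ≤ 3 → w i ≢ w j
    distinct {0} {1} _ _ = ~⇒≢ ab
    distinct {0} {2} _ _ = a≢c
    distinct {0} {3} _ _ = ≢-sym (~⇒≢ da)
    distinct {1} {2} _ _ = ~⇒≢ bc
    distinct {1} {3} _ _ = b≢d
    distinct {2} {3} _ _ = ~⇒≢ cd
    distinct {suc _} {1} (s≤s ())
    distinct {suc (suc _)} {2} (s≤s (s≤s ()))
    distinct {suc (suc (suc _))} {3} (s≤s (s≤s (s≤s ())))
    distinct {_} {suc (suc (suc (suc _)))} _ (s≤s (s≤s (s≤s ())))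

  -- Every parity argument below ends here: an odd hole can only be a pentagon, and its length then
  -- fixes the length of the path it was built from.
  odd-hole⇒5 : ∀ {k} → Hole G k → parity k ≡ 1ℙ → k ≡ 5
  odd-hole⇒5 {4} _ ()
  odd-hole⇒5 {5} _ _ = refl
  odd-hole⇒5 {6} _ ()
  odd-hole⇒5 {suc (suc (suc (suc (suc (suc (suc k))))))} H odd =
    ⊥-elim (proj₂ G∈G₂ _ (m≤m+n 7 k) (parity⇒Odd _ odd) H)
  odd-hole⇒5 {0} (() , _)
  odd-hole⇒5 {1} (s≤s () , _)
  odd-hole⇒5 {2} (s≤s (s≤s ()) , _)
  odd-hole⇒5 {3} (s≤s (s≤s (s≤s ())) , _)

  -- Five adjacencies suffice: girth 5 yields distinctness and the absence of chords. Facts are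
  -- proved for one position and carried to the others by `rot`, `rot⁻¹` and `flip`, the reflection
  -- fixing `a`.
  record Pent (a b c d e : Fin n) : Set where
    constructor pent
    field
      ab : a ~ b
      bc : b ~ c
      cd : c ~ d
      de : d ~ e
      ea : e ~ a

  rot : ∀ {a b c d e} → Pent a b c d e → Pent b c d e a
  rot (pent ab bc cd de ea) = pent bc cd de ea ab

  rot⁻¹ : ∀ {a b c d e} → Pent a b c d e → Pent e a b c d
  rot⁻¹ (pent ab bc cd de ea) = pent ea ab bc cd de

  flip : ∀ {a b c d e} → Pent a b c d e → Pent a e d c b
  flip (pent ab bc cd de ea) = pent (~-sym ea) (~-sym de) (~-sym cd) (~-sym bc) (~-sym ab)

  a≢c : ∀ {a b c d e} → Pent a b c d e → a ≢ c
  a≢c (pent _ _ cd de ea) refl = no-triangle cd de ea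

  a≁c : ∀ {a b c d e} → Pent a b c d e → ¬ a ~ c
  a≁c (pent ab bc _ _ _) ac = no-triangle ab bc (~-sym ac)

  module _ {a b c d e : Fin n} (P : Pent a b c d e) where

    pent-vertices : ℕ → Fin n
    pent-vertices = a ◂ b ◂ c ◂ d ◂ λ _ → e

    pent-step : ∀ (Q : Fin n → Fin n → Set) → Q a b → Q b c → Q c d → Q d e →
      ∀ {i} → i < 4 → Q (pent-vertices i) (pent-vertices (suc i))
    pent-step Q ab bc cd de {0} _ = ab
    pent-step Q ab bc cd de {1} _ = bc
    pent-step Q ab bc cd de {2} _ = cd
    pent-step Q ab bc cd de {3} _ = de
    pent-step Q ab bc cd de {suc (suc (suc (suc _)))} (s≤s (s≤s (s≤s (s≤s ()))))

    pent-ring : Ring pent-vertices 4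
    pent-ring = record { step = pent-step _~_ ab bc cd de ; close = ea ; distinct = distinct }
      where
      open Pent P
      distinct : ∀ {i j} → i < j → j ≤ 4 → pent-vertices i ≢ pent-vertices j
      distinct {0} {1} _ _ = ~⇒≢ ab
      distinct {0} {2} _ _ = a≢c P
      distinct {0} {3} _ _ = ≢-sym (a≢c (rot (rot (rot P))))
      distinct {0} {4} _ _ = ≢-sym (~⇒≢ ea)
      distinct {1} {2} _ _ = ~⇒≢ bc
      distinct {1} {3} _ _ = a≢c (rot P)
      distinct {1} {4} _ _ = ≢-sym (a≢c (rot⁻¹ P))
      distinct {2} {3} _ _ = ~⇒≢ cd
      distinct {2} {4} _ _ = a≢c (rot (rot P))
      distinct {3} {4} _ _ = ~⇒≢ de
      distinct {suc _} {1} (s≤s ())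
      distinct {suc (suc _)} {2} (s≤s (s≤s ()))
      distinct {suc (suc (suc _))} {3} (s≤s (s≤s (s≤s ())))
      distinct {suc (suc (suc (suc _)))} {4} (s≤s (s≤s (s≤s (s≤s ()))))
      distinct {_} {suc (suc (suc (suc (suc _))))} _ (s≤s (s≤s (s≤s (s≤s ()))))

    pent-cycle : Cycle G 5
    pent-cycle = ring⇒cycle (s≤s (s≤s z≤n)) pent-ring

    first-edge : CycleEdge pent-cycle a b
    first-edge = Fin.zero , Fin.suc Fin.zero , inj₁ refl , inj₁ (refl , refl)

    second-edge : CycleEdge pent-cycle b c
    second-edge = Fin.suc Fin.zero , Fin.suc (Fin.suc Fin.zero) , inj₁ refl , inj₁ (refl , refl)

    pent-edge-elim : ∀ {u v} (Q : Fin n → Fin n → Set) → Q a b → Q b c → Q c d → Q d e → Q e a →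
      (∀ {x y} → Q x y → ¬ SamePair x y u v) → ¬ CycleEdge pent-cycle u v
    pent-edge-elim Q ab bc cd de ea absurd (i , j , con , same) =
      absurd (consec-elim pent-vertices Q (pent-step Q ab bc cd de) ea i j con) same

  -- Otherwise `b c′` is not an edge of the first pentagon, and two distinct 5-cycles share the edge
  -- `a b`.
  pent-unique : ∀ {a b c d e c′ d′ e′} → Pent a b c d e → Pent a b c′ d′ e′ → c ≡ c′
  pent-unique {a} {b} {c} {d} {e} {c′} P P′ with c ≟ c′
  ... | yes c≡c′ = c≡c′
  ... | no  c≢c′ = ⊥-elim (edge-disjoint (pent-cycle P) (pent-cycle P′)
    ( inj₂ (b , c′ , second-edge P′ , not-edge)
    , (a , b , first-edge P , first-edge P′)))
    where
    not-edge : ¬ CycleEdge (pent-cycle P) b c′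
    not-edge = pent-edge-elim P (λ x y → ¬ SamePair x y b c′)
      (λ { (inj₁ (e , _)) → ~⇒≢ (Pent.ab P) e ; (inj₂ (e , _)) → a≢c P′ e })
      (λ { (inj₁ (_ , e)) → c≢c′ e ; (inj₂ (e , _)) → ~⇒≢ (Pent.bc P′) e })
      (λ { (inj₁ (e , _)) → ~⇒≢ (Pent.bc P) (≡-sym e) ; (inj₂ (e , _)) → c≢c′ e })
      (λ { (inj₁ (e , _)) → a≢c (rot P) (≡-sym e) ; (inj₂ (_ , e)) → a≢c (rot⁻¹ P) e })
      (λ { (inj₁ (e , _)) → a≢c (rot⁻¹ P) e ; (inj₂ (_ , e)) → ~⇒≢ (Pent.ab P) e })
      (λ f → f)

  -- Vertices off a pentagon and their neighbours on it.

  record Off (a b c d e v : Fin n) : Set where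
    constructor off
    field
      a≢ : a ≢ v
      b≢ : b ≢ v
      c≢ : c ≢ v
      d≢ : d ≢ v
      e≢ : e ≢ v
  open Off

  off-rot : ∀ {a b c d e v} → Off a b c d e v → Off b c d e a v
  off-rot (off p q r s t) = off q r s t p

  off-rot⁻¹ : ∀ {a b c d e v} → Off a b c d e v → Off e a b c d v
  off-rot⁻¹ (off p q r s t) = off t p q r s

  off-flip : ∀ {a b c d e v} → Off a b c d e v → Off a e d c b v
  off-flip (off p q r s t) = off p t s r q

  module _ {a b c d e : Fin n} (P : Pent a b c d e) where
    open Pent P

    one-neighbour₁₂ : ∀ {v} → a ~ v → b ~ v → ⊥
    one-neighbour₁₂ av bv = no-triangle ab bv (~-sym av)

    one-neighbour₁₃ : ∀ {v} → Off a b c d e v → a ~ v → c ~ v → ⊥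
    one-neighbour₁₃ o av cv = no-square ab bc cv (~-sym av) (a≢c P) (b≢ o)

    neighbours-stable₁₂ : ∀ {u v} → Off a b c d e u → Off a b c d e v → a ~ u → b ~ v → ¬ u ~ v
    neighbours-stable₁₂ o o′ au bv uv = no-square ab bv (~-sym uv) (~-sym au) (a≢ o′) (b≢ o)

    -- An edge `u v` would complete a pentagon `b c v u a` sharing `b c` with `P`, so that `v` would
    -- be `d`.
    neighbours-stable₁₃ : ∀ {u v} → Off a b c d e v → a ~ u → c ~ v → ¬ u ~ v
    neighbours-stable₁₃ o au cv uv =
      d≢ o (pent-unique (rot P) (pent bc cv (~-sym uv) (~-sym au) ab))

    -- Parity rules for induced paths off a pentagon.

    module _ {w p} (W : InducedPath w p) (out : ∀ {j} → j ≤ p → Off a b c d e (w j)) where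

      -- Each rule prolongs W by an arc of the pentagon to a hole; ruleᵢⱼ is for a path from a neighbour of the
      -- i-th vertex a, b, c, … to one of the j-th. From a to c the arc is abc (short) or aedc (long).

      rule₁₁ : 0 < p → a ~ w 0 → a ~ w p → (∀ {j} → 0 < j → j < p → ¬ a ~ w j) →
        parity p ≡ 0ℙ ⊎ p ≡ 3
      rule₁₁ 0<p a₀ aₚ no-a with m≤n⇒m<n∨m≡n 0<p
      ... | inj₂ refl = ⊥-elim (no-triangle a₀ (InducedPath.step W z<s) (~-sym aₚ))
      ... | inj₁ 1<p with parity p in eq
      ... | 0ℙ = inj₁ refl
      -- The hole has length `2 + p`, so `p ≡ 3` is the case of a pentagon meeting the given one in
      -- `a`.
      ... | 1ℙ = inj₂ (+-cancelˡ-≡ 2 p 3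
        (odd-hole⇒5 (close-path W 1<p a₀ aₚ no-a (λ l → a≢ (out l))) eq))

      rule₁₂ : 0 < p → a ~ w 0 → b ~ w p → (∀ {j} → 0 < j → j < p → ¬ a ~ w j) →
        (∀ {j} → 0 < j → j < p → ¬ b ~ w j) → parity p ≡ 1ℙ
      rule₁₂ 0<p a₀ bₚ no-a no-b with parity p in eq
      ... | 1ℙ = refl
      ... | 0ℙ = ⊥-elim (five (+-cancelˡ-≡ 3 p 2 (odd-hole⇒5 hole (even⇒suc-odd p eq))))
        where
        far-a : ∀ {j} → 0 < j → j ≤ p → ¬ a ~ w j
        far-a 0<j j≤p aj with m≤n⇒m<n∨m≡n j≤p
        ... | inj₁ j<p  = no-a 0<j j<p aj
        ... | inj₂ refl = one-neighbour₁₂ aj bₚ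
        W₁ : InducedPath (a ◂ w) (suc p)
        W₁ = cons-path W a₀ far-a (λ l → a≢ (out l))
        far-b : ∀ {j} → 0 < j → j < suc p → ¬ b ~ (a ◂ w) j
        far-b {1}           _ _ bj = one-neighbour₁₂ a₀ bj
        far-b {suc (suc j)} _ l bj = no-b z<s (s≤s⁻¹ l) bj
        new-b : ∀ {j} → j ≤ suc p → b ≢ (a ◂ w) j
        new-b {zero}  _ = ≢-sym (~⇒≢ ab)
        new-b {suc j} l = b≢ (out (s≤s⁻¹ l))
        hole : Hole G (3 + p)
        hole = close-path W₁ (s≤s 0<p) (~-sym ab) bₚ far-b new-b
        -- For `p ≡ 2` the hole is the pentagon `b a (w 0) (w 1) (w 2)`; it shares `a b` with `P`,
        -- which forces `e ≡ w 0`.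
        five : p ≢ 2
        five refl = e≢ (out z≤n) (pent-unique (rot⁻¹ (flip P))
          (pent (~-sym ab) a₀ (InducedPath.step W z<s) (InducedPath.step W (s<s z<s)) (~-sym bₚ)))

      rule₁₃-short : a ~ w 0 → c ~ w p → (∀ {j} → 0 < j → j < p → ¬ a ~ w j) →
        (∀ {j} → 0 < j → j < p → ¬ b ~ w j) → (∀ {j} → 0 < j → j < p → ¬ c ~ w j) → parity p ≡ 0ℙ
      rule₁₃-short a₀ cₚ no-a no-b no-c with parity p in eq
      ... | 0ℙ = refl
      ... | 1ℙ = ⊥-elim (one (+-cancelˡ-≡ 4 p 1 (odd-hole⇒5 hole eq)))
        where
        far-a : ∀ {j} → 0 < j → j ≤ p → ¬ a ~ w j
        far-a 0<j j≤p aj with m≤n⇒m<n∨m≡n j≤p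
        ... | inj₁ j<p  = no-a 0<j j<p aj
        ... | inj₂ refl = one-neighbour₁₃ (out ≤-refl) aj cₚ
        far-b : ∀ {j} → j ≤ p → ¬ b ~ w j
        far-b {zero}  _   bj = one-neighbour₁₂ a₀ bj
        far-b {suc j} j≤p bj with m≤n⇒m<n∨m≡n j≤p
        ... | inj₁ j<p  = no-b z<s j<p bj
        ... | inj₂ refl = no-triangle bc cₚ (~-sym bj)
        W₁ : InducedPath (a ◂ w) (1 + p)
        W₁ = cons-path W a₀ far-a (λ l → a≢ (out l))
        W₂ : InducedPath (b ◂ a ◂ w) (2 + p)
        W₂ = cons-path W₁ (~-sym ab)
          (λ { {1} _ _ → far-b z≤n ; {suc (suc j)} _ l → far-b (s≤s⁻¹ l) })
          (λ { {zero} _ → ≢-sym (~⇒≢ ab) ; {suc j} l → b≢ (out (s≤s⁻¹ l)) })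
        hole : Hole G (4 + p)
        hole = close-path W₂ (s≤s (s≤s z≤n)) (~-sym bc) cₚ
          (λ { {1} _ _ ca → a≁c P (~-sym ca)
             ; {2} _ _ c₀ → one-neighbour₁₃ (out z≤n) a₀ c₀
             ; {suc (suc (suc j))} _ l → no-c z<s (s≤s⁻¹ (s≤s⁻¹ l)) })
          (λ { {0} _ → ≢-sym (~⇒≢ bc)
             ; {1} _ → ≢-sym (a≢c P)
             ; {suc (suc j)} l → c≢ (out (s≤s⁻¹ (s≤s⁻¹ l))) })
        one : p ≢ 1
        one refl = neighbours-stable₁₃ (out ≤-refl) a₀ cₚ (InducedPath.step W z<s)

      rule₁₃-long : 0 < p → a ~ w 0 → c ~ w p → (∀ {j} → 0 < j → j < p → ¬ a ~ w j) →
        (∀ {j} → 0 < j → j < p → ¬ c ~ w j) → (∀ {j} → 0 < j → j < p → ¬ d ~ w j) →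
        (∀ {j} → 0 < j → j < p → ¬ e ~ w j) → parity p ≡ 1ℙ
      rule₁₃-long 0<p a₀ cₚ no-a no-c no-d no-e with parity p in eq
      ... | 1ℙ = refl
      -- The hole has length `5 + p`, so it could be a pentagon only for `p ≡ 0`.
      ... | 0ℙ = ⊥-elim (m<n⇒n≢0 0<p (+-cancelˡ-≡ 5 p 0 (odd-hole⇒5 hole (even⇒suc-odd p eq))))
        where
        far-a : ∀ {j} → 0 < j → j ≤ p → ¬ a ~ w j
        far-a 0<j j≤p aj with m≤n⇒m<n∨m≡n j≤p
        ... | inj₁ j<p  = no-a 0<j j<p aj
        ... | inj₂ refl = one-neighbour₁₃ (out ≤-refl) aj cₚ
        far-e : ∀ {j} → j ≤ p → ¬ e ~ w j
        far-e {zero}  _   ej = no-triangle ea a₀ (~-sym ej)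
        far-e {suc j} j≤p ej with m≤n⇒m<n∨m≡n j≤p
        ... | inj₁ j<p  = no-e z<s j<p ej
        ... | inj₂ refl = no-square cd de ej (~-sym cₚ) (a≢c (rot (rot P))) (d≢ (out j≤p))
        far-d : ∀ {j} → j ≤ p → ¬ d ~ w j
        far-d {zero}  _   dj = no-square de ea a₀ (~-sym dj) (a≢c (rot (rot (rot P)))) (e≢ (out z≤n))
        far-d {suc j} j≤p dj with m≤n⇒m<n∨m≡n j≤p
        ... | inj₁ j<p  = no-d z<s j<p dj
        ... | inj₂ refl = no-triangle cd dj (~-sym cₚ)
        W₁ : InducedPath (a ◂ w) (1 + p)
        W₁ = cons-path W a₀ far-a (λ l → a≢ (out l))
        W₂ : InducedPath (e ◂ a ◂ w) (2 + p)
        W₂ = cons-path W₁ ea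
          (λ { {1} _ _ → far-e z≤n ; {suc (suc j)} _ l → far-e (s≤s⁻¹ l) })
          (λ { {zero} _ → ~⇒≢ ea ; {suc j} l → e≢ (out (s≤s⁻¹ l)) })
        W₃ : InducedPath (d ◂ e ◂ a ◂ w) (3 + p)
        W₃ = cons-path W₂ de
          (λ { {1} _ _ → a≁c (rot (rot (rot P)))
             ; {2} _ _ → far-d z≤n
             ; {suc (suc (suc j))} _ l → far-d (s≤s⁻¹ (s≤s⁻¹ l)) })
          (λ { {0} _ → ~⇒≢ de
             ; {1} _ → a≢c (rot (rot (rot P)))
             ; {suc (suc j)} l → d≢ (out (s≤s⁻¹ (s≤s⁻¹ l))) })
        hole : Hole G (5 + p)
        hole = close-path W₃ (s≤s (s≤s z≤n)) cd cₚ
          (λ { {1} _ _ → a≁c (rot (rot P))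
             ; {2} _ _ ca → a≁c P (~-sym ca)
             ; {3} _ _ c₀ → one-neighbour₁₃ (out z≤n) a₀ c₀
             ; {suc (suc (suc (suc j)))} _ l → no-c z<s (s≤s⁻¹ (s≤s⁻¹ (s≤s⁻¹ l))) })
          (λ { {0} _ → ~⇒≢ cd
             ; {1} _ → a≢c (rot (rot P))
             ; {2} _ → ≢-sym (a≢c P)
             ; {suc (suc (suc j))} l → c≢ (out (s≤s⁻¹ (s≤s⁻¹ (s≤s⁻¹ l)))) })

  -- Parities of the positions at which an induced path meets neighbours of the pentagon.

  module _ {w : ℕ → Fin n} {p : ℕ} (W : InducedPath w p) where

    Free : Fin n → ℕ → ℕ → Set
    Free x s t = ∀ {j} → s < j → j < t → ¬ x ~ w j

    shorten : ∀ {x s s′ t t′} → Free x s t → s ≤ s′ → t′ ≤ t → Free x s′ t′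
    shorten free s≤s′ t′≤t s′<j j<t′ = free (≤-<-trans s≤s′ s′<j) (<-≤-trans j<t′ t′≤t)

    module Rules {a b c d e : Fin n} (P : Pent a b c d e) (out : ∀ {j} → j ≤ p → Off a b c d e (w j))
      {s t : ℕ} (s<t : s < t) (t≤p : t ≤ p) where

      private
        s≤t = <⇒≤ s<t

        at-start : ∀ {x} → x ~ w s → x ~ w (s + 0)
        at-start {x} = subst (λ k → x ~ w k) (≡-sym (+-identityʳ s))

        at-finish : ∀ {x} → x ~ w t → x ~ w (s + (t ∸ s))
        at-finish {x} = subst (λ k → x ~ w k) (≡-sym (m+[n∸m]≡n s≤t))

        shift : ∀ {x} → Free x s t → ∀ {j} → 0 < j → j < t ∸ s → ¬ x ~ w (s + j)
        shift free {j} 0<j j<t∸s = free (m<m+n s 0<j) (subst (s + j <_) (m+[n∸m]≡n s≤t) (+-monoʳ-< s j<t∸s))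

        seg = segment W s≤t t≤p

        out′ : ∀ {j} → j ≤ t ∸ s → Off a b c d e (w (s + j))
        out′ {j} j≤t∸s = out (≤-trans (subst (s + j ≤_) (m+[n∸m]≡n s≤t) (+-monoʳ-≤ s j≤t∸s)) t≤p)

        same : parity (t ∸ s) ≡ 0ℙ → parity t ≡ parity s
        same eq = trans (parity-∸ s≤t) (cong (ℙ._+ parity s) eq)

        opposite : parity (t ∸ s) ≡ 1ℙ → parity t ≡ parity s ⁻¹
        opposite eq = trans (parity-∸ s≤t) (cong (ℙ._+ parity s) eq)

      segment₁₁ : a ~ w s → a ~ w t → Free a s t → parity t ≡ parity s ⊎ t ≡ 3 + s
      segment₁₁ aₛ aₜ no-a with rule₁₁ P seg out′ (m<n⇒0<n∸m s<t) (at-start aₛ) (at-finish aₜ) (shift no-a)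
      ... | inj₁ even  = inj₁ (same even)
      ... | inj₂ three = inj₂ (trans (≡-sym (m∸n+n≡m s≤t)) (cong (_+ s) three))

      segment₁₂ : a ~ w s → b ~ w t → Free a s t → Free b s t → parity t ≡ parity s ⁻¹
      segment₁₂ aₛ bₜ no-a no-b =
        opposite (rule₁₂ P seg out′ (m<n⇒0<n∸m s<t) (at-start aₛ) (at-finish bₜ) (shift no-a) (shift no-b))

      segment₁₃-short : a ~ w s → c ~ w t → Free a s t → Free b s t → Free c s t → parity t ≡ parity s
      segment₁₃-short aₛ cₜ no-a no-b no-c =
        same (rule₁₃-short P seg out′ (at-start aₛ) (at-finish cₜ) (shift no-a) (shift no-b) (shift no-c))

      segment₁₃-long : a ~ w s → c ~ w t → Free a s t → Free c s t → Free d s t → Free e s t →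
        parity t ≡ parity s ⁻¹
      segment₁₃-long aₛ cₜ no-a no-c no-d no-e = opposite
        (rule₁₃-long P seg out′ (m<n⇒0<n∸m s<t) (at-start aₛ) (at-finish cₜ) (shift no-a) (shift no-c) (shift no-d) (shift no-e))

    module _ {a b c d e : Fin n} (P : Pent a b c d e) (out : ∀ {j} → j ≤ p → Off a b c d e (w j))
      (a₀ : a ~ w 0) (dₚ : d ~ w p) (no-a : Free a 0 p) (no-d : Free d 0 p) (no-e : Free e 0 p) where

      private
        B? : Decidable (λ j → b ~ w j)
        B? j = dec G b (w j)

        C? : Decidable (λ j → c ~ w j)
        C? j = dec G c (w j)

        0<p : 0 < p
        0<p with m≤n⇒m<n∨m≡n (z≤n {p})
        ... | inj₁ l    = l
        ... | inj₂ refl = ⊥-elim (one-neighbour₁₃ (rot (rot (rot P))) (off-rot (off-rot (off-rot (out z≤n)))) dₚ a₀)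

        p-even : parity p ≡ 0ℙ
        p-even = Rules.segment₁₃-short (flip P) (λ l → off-flip (out l)) 0<p ≤-refl a₀ dₚ no-a no-e no-d

        B-inside : ∀ {z} → z ≤ p → b ~ w z → 0 < z × z < p
        B-inside {zero}  _ bz = ⊥-elim (one-neighbour₁₂ P a₀ bz)
        B-inside {suc z} z≤p bz with m≤n⇒m<n∨m≡n z≤p
        ... | inj₁ z<p  = z<s , z<p
        ... | inj₂ refl = ⊥-elim (one-neighbour₁₃ (rot P) (off-rot (out ≤-refl)) bz dₚ)

        C-inside : ∀ {y} → y ≤ p → c ~ w y → 0 < y × y < p
        C-inside {zero}  _ cy = ⊥-elim (one-neighbour₁₃ P (out z≤n) a₀ cy)
        C-inside {suc y} y≤p cy with m≤n⇒m<n∨m≡n y≤p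
        ... | inj₁ y<p  = z<s , y<p
        ... | inj₂ refl = ⊥-elim (one-neighbour₁₂ (rot (rot P)) cy dₚ)

        first-C-odd : ∀ {y} → y ≤ p → c ~ w y → Free c 0 y → parity y ≡ 1ℙ
        first-C-odd y≤p cy no-c = Rules.segment₁₃-long P out (proj₁ (C-inside y≤p cy)) y≤p a₀ cy
          (shorten no-a z≤n y≤p) no-c (shorten no-d z≤n y≤p) (shorten no-e z≤n y≤p)

        -- From `z` on the path has no neighbours of the arc `b a e d` except at its ends, so `z`
        -- and the even `p` have opposite parities.
        last-B-odd : ∀ {z} → z ≤ p → b ~ w z → Free b z p → parity z ≡ 1ℙ
        last-B-odd {z} z≤p bz no-b with parity z in eq
        ... | 1ℙ = refl
        ... | 0ℙ with trans (≡-sym p-even) (Rules.segment₁₃-long (rot P) (λ l → off-rot (out l))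
                        (proj₂ (B-inside z≤p bz)) ≤-refl bz dₚ no-b
                        (shorten no-d z≤n ≤-refl) (shorten no-e z≤n ≤-refl) (shorten no-a z≤n ≤-refl))
        ... | q rewrite eq with q
        ... | ()

        -- Without an earlier neighbour of `b`, the first neighbour of `c` would be at an odd
        -- position by the arc `a e d c` and at an even one by the arc `a b c`.
        B-before-C : ∀ {y} → y ≤ p → c ~ w y → ¬ (∀ {k} → k < y → ¬ b ~ w k)
        B-before-C {y} y≤p cy no-b with first-after C? 0 (suc y)
        ... | inj₂ no-c = no-c (proj₁ (C-inside y≤p cy)) ≤-refl cy
        ... | inj₁ (y′ , 0<y′ , y′<1+y , cy′ , no-c) with trans (≡-sym (first-C-odd y′≤p cy′ no-c))
              (Rules.segment₁₃-short P out 0<y′ y′≤p a₀ cy′ (shorten no-a z≤n y′≤p)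
                (λ _ l → no-b (<-≤-trans l (s≤s⁻¹ y′<1+y))) no-c)
          where
          y′≤p : y′ ≤ p
          y′≤p = ≤-trans (s≤s⁻¹ y′<1+y) y≤p
        ... | ()

        B≁C : ∀ {z y} → z ≤ p → y ≤ p → b ~ w z → c ~ w y → ¬ w z ~ w y
        B≁C z≤p y≤p = neighbours-stable₁₂ (rot P) (off-rot (out z≤p)) (off-rot (out y≤p))

        CB-gap : ∀ {y z} → y < z → z ≤ p → b ~ w z → c ~ w y → suc y < z
        CB-gap y<z z≤p bz cy with m≤n⇒m<n∨m≡n y<z
        ... | inj₁ l    = l
        ... | inj₂ refl = ⊥-elim (B≁C z≤p (<⇒≤ z≤p) bz cy (~-sym (InducedPath.step W z≤p)))

        BC-gap : ∀ {z y} → z < y → y ≤ p → b ~ w z → c ~ w y → suc z < y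
        BC-gap z<y y≤p bz cy with m≤n⇒m<n∨m≡n z<y
        ... | inj₁ l    = l
        ... | inj₂ refl = ⊥-elim (B≁C (<⇒≤ y≤p) y≤p bz cy (InducedPath.step W y≤p))

        -- The gaps on both sides of `m` give `t` at least `4 + s`, which rules out the pentagon
        -- case of `segment₁₁`.
        same-parity : ∀ {s m t} → suc s < m → suc m < t → parity t ≡ parity s ⊎ t ≡ 3 + s → parity t ≡ parity s
        same-parity _ _ (inj₁ eq) = eq
        same-parity l l′ (inj₂ refl) = ⊥-elim (<⇒≱ (≤-<-trans (s≤s l) l′) ≤-refl)

        -- Consider the neighbours of b and c along W. Two consecutive neighbours of b with a neighbour of c
        -- between them are too far apart to lie on a 5-cycle with b, hence have equal parity, and likewise with b
        -- and c exchanged. So every maximal block of neighbours of c that is followed by a neighbour of b ends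
        -- with the parity with which it starts, and that parity is passed on from one block to the next.
        BC-odd : ∀ z {y} → z < y → y ≤ p → b ~ w z → c ~ w y → Free b z y → Free c z y → parity y ≡ 1ℙ
        BC-odd = <-rec _ step
          where
          Claim : ℕ → Set
          Claim z = ∀ {y} → z < y → y ≤ p → b ~ w z → c ~ w y → Free b z y → Free c z y → parity y ≡ 1ℙ
          step : ∀ z → (∀ {z′} → z′ < z → Claim z′) → Claim z
          step z rec {y} z<y y≤p bz cy no-b no-c with last-before C? z
          ... | inj₂ none = first-C-odd y≤p cy no-c₀
            where
            no-c₀ : Free c 0 y
            no-c₀ {j} _ j<y with <-cmp j z
            ... | tri< j<z _ _    = none j<z
            ... | tri≈ _ refl _   = λ cz → one-neighbour₁₂ (rot P) bz cz
            ... | tri> _ _ z<j    = no-c z<j j<y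
          ... | inj₁ (y₀ , y₀<z , cy₀ , none) with last-before B? y₀
          ... | inj₂ no-b₀ = ⊥-elim (B-before-C (<⇒≤ (<-≤-trans (<-trans y₀<z z<y) y≤p)) cy₀ no-b₀)
          ... | inj₁ (z₀ , z₀<y₀ , bz₀ , none-b₀) with first-after B? y₀ (suc z) | first-after C? z₀ (suc y₀)
          ... | inj₂ no-b₁ | _ = ⊥-elim (no-b₁ y₀<z ≤-refl bz)
          ... | inj₁ _ | inj₂ no-c₁ = ⊥-elim (no-c₁ z₀<y₀ ≤-refl cy₀)
          -- The order along `W` is `z₀ < y₁ ≤ y₀ < z₁ ≤ z < y`. The hypothesis at `z₀` makes `y₁`
          -- odd; then `z₀` and `z₁` are even, and `y₀` and `y` odd.
          ... | inj₁ (z₁ , y₀<z₁ , z₁<1+z , bz₁ , none-b₁) | inj₁ (y₁ , z₀<y₁ , y₁<1+y₀ , cy₁ , none-c₁) =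
            trans y~y₀ y₀-odd
            where
            z≤p : z ≤ p
            z≤p = <⇒≤ (<-≤-trans z<y y≤p)
            z₁≤z : z₁ ≤ z
            z₁≤z = s≤s⁻¹ z₁<1+z
            z₁≤p : z₁ ≤ p
            z₁≤p = ≤-trans z₁≤z z≤p
            y₁≤y₀ : y₁ ≤ y₀
            y₁≤y₀ = s≤s⁻¹ y₁<1+y₀
            y₀≤p : y₀ ≤ p
            y₀≤p = <⇒≤ (<-≤-trans y₀<z z≤p)
            y₁≤p : y₁ ≤ p
            y₁≤p = ≤-trans y₁≤y₀ y₀≤p
            no-c₀ : Free c y₀ y
            no-c₀ {j} y₀<j j<y with <-cmp j z
            ... | tri< j<z _ _  = none y₀<j j<z
            ... | tri≈ _ refl _ = λ cz → one-neighbour₁₂ (rot P) bz cz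
            ... | tri> _ _ z<j  = no-c z<j j<y
            no-b₀ : Free b z₀ z₁
            no-b₀ {j} z₀<j j<z₁ with <-cmp j y₀
            ... | tri< j<y₀ _ _ = none-b₀ z₀<j j<y₀
            ... | tri≈ _ refl _ = λ bj → one-neighbour₁₂ (rot P) bj cy₀
            ... | tri> _ _ y₀<j = none-b₁ y₀<j j<z₁
            y~y₀ : parity y ≡ parity y₀
            y~y₀ = same-parity (CB-gap y₀<z z≤p bz cy₀) (BC-gap z<y y≤p bz cy)
              (Rules.segment₁₁ (rot (rot P)) (λ l → off-rot (off-rot (out l))) (<-trans y₀<z z<y) y≤p cy₀ cy no-c₀)
            z₁~z₀ : parity z₁ ≡ parity z₀
            z₁~z₀ = same-parity (BC-gap z₀<y₀ y₀≤p bz₀ cy₀) (CB-gap y₀<z₁ z₁≤p bz₁ cy₀)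
              (Rules.segment₁₁ (rot P) (λ l → off-rot (out l)) (<-trans z₀<y₀ y₀<z₁) z₁≤p bz₀ bz₁ no-b₀)
            z₁≁y₀ : parity z₁ ≡ parity y₀ ⁻¹
            z₁≁y₀ = Rules.segment₁₂ (flip (rot (rot P))) (λ l → off-flip (off-rot (off-rot (out l)))) y₀<z₁ z₁≤p cy₀ bz₁
              (shorten none ≤-refl z₁≤z) none-b₁
            y₁≁z₀ : parity y₁ ≡ parity z₀ ⁻¹
            y₁≁z₀ = Rules.segment₁₂ (rot P) (λ l → off-rot (out l)) z₀<y₁ y₁≤p bz₀ cy₁
              (shorten none-b₀ ≤-refl y₁≤y₀) none-c₁
            y₁-odd : parity y₁ ≡ 1ℙ
            y₁-odd = rec (<-trans z₀<y₀ y₀<z) z₀<y₁ y₁≤p bz₀ cy₁ (shorten none-b₀ ≤-refl y₁≤y₀) none-c₁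
            y₀-odd : parity y₀ ≡ 1ℙ
            y₀-odd = ⁻¹-injective
              (trans (≡-sym z₁≁y₀) (trans z₁~z₀ (⁻¹-injective (trans (≡-sym y₁≁z₀) y₁-odd))))

      -- The arc `a e d` makes `p` even, and the last neighbour of `b` is at an odd position. If no
      -- neighbour of `c` follows, the arc `b c d` makes `p` odd; if one does, the first is at an
      -- odd position by `BC-odd` and at an even one by `segment₁₂`. With no neighbour of `b` there
      -- is none of `c`, and the arc `a b c d` makes `p` odd.
      no-crossing : ⊥
      no-crossing with last-before B? p
      ... | inj₂ no-b with trans (≡-sym p-even) (Rules.segment₁₃-long (flip P) (λ l → off-flip (out l)) 0<p ≤-refl a₀ dₚ
              no-a no-d no-c (λ _ → no-b))
        where
        no-c : Free c 0 p
        no-c _ j<p cj = B-before-C (<⇒≤ j<p) cj (λ k<j → no-b (<-trans k<j j<p))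
      ... | ()
      no-crossing | inj₁ (z , z<p , bz , no-b) with first-after C? z p
      ... | inj₂ no-c with trans (≡-sym (last-B-odd (<⇒≤ z<p) bz no-b)) (trans (≡-sym
              (Rules.segment₁₃-short (rot P) (λ l → off-rot (out l)) z<p ≤-refl bz dₚ no-b no-c (shorten no-d z≤n ≤-refl)))
              p-even)
      ... | ()
      no-crossing | inj₁ (z , z<p , bz , no-b) | inj₁ (y , z<y , y<p , cy , no-c)
        with trans (≡-sym (BC-odd z z<y (<⇒≤ y<p) bz cy no-b′ no-c))
          (trans (Rules.segment₁₂ (rot P) (λ l → off-rot (out l)) z<y (<⇒≤ y<p) bz cy no-b′ no-c)
            (cong _⁻¹ (last-B-odd (<⇒≤ z<p) bz no-b)))
        where
        no-b′ : Free b z y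
        no-b′ = shorten no-b ≤-refl (<⇒≤ y<p)
      ... | ()

  -- Which vertices of a pentagon a connected set can attach to.

  module _ {P : Fin n → Set} where

    -- In a shortest such walk any repetition, chord, or interior neighbour of `a` or `d` would
    -- allow a shorter one. It is therefore an induced path to which `no-crossing` applies.
    no-walk-avoiding : ∀ {a b c d e} → Pent a b c d e → (∀ {x} → P x → Off a b c d e x) → (∀ {x} → P x → ¬ e ~ x) →
      ∀ l {u v} → a ~ u → d ~ v → ¬ Walk P u v l
    no-walk-avoiding {a} {b} {c} {d} {e} C out no-e = <-rec _ step
      where
      Claim : ℕ → Set
      Claim l = ∀ {u v} → a ~ u → d ~ v → ¬ Walk P u v l
      step : ∀ l → (∀ {m} → m < l → Claim m) → Claim l
      step l shorter {u} {v} au dv X = no-crossing path C (λ _ → out (at-P X _))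
        (subst (a ~_) (≡-sym (at-0 X)) au) (subst (d ~_) (≡-sym (at-end X)) dv)
        (λ 0<j j<l aj → shorter (∸-monoʳ-< 0<j (<⇒≤ j<l)) aj dv (drop X (<⇒≤ j<l)))
        (λ 0<j j<l dj → shorter j<l au dj (take X (<⇒≤ j<l)))
        (λ _ _ → no-e (at-P X _))
        where
        path : InducedPath (at X) l
        path = record
          { step      = at-step X
          ; distinct  = λ i<j j≤l eq → shorter (contract-shorter i<j j≤l) au dv (contract X i<j j≤l eq)
          ; chordless = λ i<j j≤l e → shorter (shortcut-shorter i<j j≤l) au dv (shortcut X (<⇒≤ i<j) j≤l e)
          }

  module _ {P : Fin n → Set} where

    module _ {a b c d e : Fin n} (C : Pent a b c d e) (out : ∀ {x} → P x → Off a b c d e x) where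

      -- Cut `Y` at its first neighbour of `d` or `e`. In the first case it leads from `a` to `d`
      -- avoiding `e`; in the second, preceded by `X` reversed, from `c` to `e` avoiding `d`. Both
      -- contradict `no-walk-avoiding`.
      walk₁₃-avoiding₄ : ∀ {u v z l m} → a ~ u → c ~ v → Walk (λ x → P x × ¬ d ~ x) u v l →
        d ~ z ⊎ e ~ z → ¬ Walk P u z m
      walk₁₃-avoiding₄ {u} {v} {z} {l} au cv X hit Y with first-hit DE? Y hit
        where
        DE? : Decidable (λ x → d ~ x ⊎ e ~ x)
        DE? x = dec G d x ⊎-dec dec G e x
      ... | z′ , m′ , inj₁ dz′ , Z = no-walk-avoiding C (λ p → out (proj₁ p)) (λ p → no-e p) m′ au dz′ Z
        where
        no-e : ∀ {x} → P x × (d ~ x ⊎ e ~ x → x ≡ z′) → ¬ e ~ x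
        no-e (_ , stop) ex with stop (inj₂ ex)
        ... | refl = one-neighbour₁₂ (rot (rot (rot C))) dz′ ex
      ... | z′ , m′ , inj₂ ez′ , Z = no-walk-avoiding (flip (rot (rot C)))
        (λ p → off-flip (off-rot (off-rot (out (proj₁ p))))) proj₂ (l + m′) cv ez′ (reverse X ++ map avoid Z)
        where
        avoid : ∀ {x} → P x × (d ~ x ⊎ e ~ x → x ≡ z′) → P x × ¬ d ~ x
        avoid {x} (p , stop) = p , no-d
          where
          no-d : ¬ d ~ x
          no-d dx with stop (inj₁ dx)
          ... | refl = one-neighbour₁₂ (rot (rot (rot C))) dx ez′

    -- Cut `X` at its first neighbour of `c` or `d`. If it is one of `d`, reflect the pentagon,
    -- which exchanges `c` and `d`; the whole of `X` then serves as the second walk, since it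
    -- reaches a neighbour of `c`.
    attached-within-P₃ : ∀ {a b c d e} → Pent a b c d e → (∀ {x} → P x → Off a b c d e x) →
      ∀ {u v z l m} → a ~ u → c ~ v → d ~ z ⊎ e ~ z → Walk P u v l → ¬ Walk P u z m
    attached-within-P₃ {a} {b} {c} {d} {e} C out {u} {v} au cv hit X Y with first-hit CD? X (inj₁ cv)
      where
      CD? : Decidable (λ x → c ~ x ⊎ d ~ x)
      CD? x = dec G c x ⊎-dec dec G d x
    ... | z , _ , inj₁ cz , Z = walk₁₃-avoiding₄ C out au cz (map avoid Z) hit Y
      where
      avoid : ∀ {x} → P x × (c ~ x ⊎ d ~ x → x ≡ z) → P x × ¬ d ~ x
      avoid (p , stop) = p , no-d
        where
        no-d : ¬ d ~ _
        no-d dx with stop (inj₂ dx)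
        ... | refl = one-neighbour₁₂ (rot (rot C)) cz dx
    ... | z , _ , inj₂ dz , Z = walk₁₃-avoiding₄ (flip C) (λ p → off-flip (out p)) au dz (map avoid Z) (inj₁ cv) X
      where
      avoid : ∀ {x} → P x × (c ~ x ⊎ d ~ x → x ≡ z) → P x × ¬ c ~ x
      avoid (p , stop) = p , no-c
        where
        no-c : ¬ c ~ _
        no-c cx with stop (inj₁ cx)
        ... | refl = one-neighbour₁₂ (rot (rot C)) cx dz

  -- Odd closed walks and pentagons.

  PentIn : (Fin n → Set) → Set
  PentIn P = ∃₂ λ a b → ∃₂ λ c d → ∃ λ e → Pent a b c d e × P a × P b × P c × P d × P e

  module _ {P : Fin n → Set} (no-pent : ¬ PentIn P) where

    -- The closed walk is an even walk together with the edge from `v` back to `u`. A repeated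
    -- vertex or a chord would split off a shorter odd closed walk, so a shortest one is a loop, a
    -- triangle or an odd hole, and the hole is a pentagon in `P`.
    no-odd-closed-walk : ∀ l {u v} → parity l ≡ 0ℙ → v ~ u → ¬ Walk P u v l
    no-odd-closed-walk = <-rec _ step
      where
      Claim : ℕ → Set
      Claim l = ∀ {u v} → parity l ≡ 0ℙ → v ~ u → ¬ Walk P u v l
      step : ∀ l → (∀ {m} → m < l → Claim m) → Claim l
      step l shorter {u} {v} even v~u X = finish l refl
        where
        distinct : ∀ {i j} → i < j → j ≤ l → at X i ≢ at X j
        distinct {i} {suc j} i<j j<l eq with parity (suc j ∸ i) in odd | parity-splice (<⇒≤ i<j) j<l
        -- The odd excursion is itself closed: its last step, from `j` to `suc j`, serves as the
        -- closing edge.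
        ... | 1ℙ | _ = shorter (≤-<-trans (m∸n≤m j i) j<l)
          (⁻¹-injective (trans (≡-sym (parity-suc (j ∸ i))) (trans (cong parity (≡-sym (+-∸-assoc 1 (s≤s⁻¹ i<j)))) odd)))
          (subst (at X j ~_) (≡-sym eq) (at-step X j<l))
          (slice X (s≤s⁻¹ i<j) (<⇒≤ j<l))
        ... | 0ℙ | split = shorter (contract-shorter i<j j<l)
          (trans (≡-sym (trans split (ℙₚ.+-identityʳ _))) even) v~u (contract X i<j j<l eq)
        chord : ∀ {i j} → suc i < j → j ≤ l → at X i ~ at X j → i ≡ 0 × j ≡ l
        chord {i} {j} i<j j≤l e with parity (j ∸ i) in odd | parity-splice (<⇒≤ (<⇒≤ i<j)) j≤l
        ... | 1ℙ | split = ⊥-elim (shorter (shortcut-shorter i<j j≤l)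
          (trans (cong parity (+-suc i (l ∸ j))) (trans (parity-suc (i + (l ∸ j)))
            (trans (≡-sym (ℙₚ.+-comm (parity (i + (l ∸ j))) 1ℙ)) (trans (≡-sym split) even))))
          v~u (shortcut X (<⇒≤ i<j) j≤l e))
        -- The chord closes the even slice from `i` to `j` to an odd closed walk, which is shorter
        -- unless the slice is all of `X`.
        ... | 0ℙ | _ with i | m≤n⇒m<n∨m≡n j≤l
        ... | zero   | inj₂ j≡l = refl , j≡l
        ... | zero   | inj₁ j<l = ⊥-elim (shorter j<l odd (~-sym e) (slice X z≤n j≤l))
        ... | suc i′ | _ = ⊥-elim (shorter (<-≤-trans (∸-monoʳ-< z<s (<⇒≤ (<⇒≤ i<j))) j≤l) odd (~-sym e)
          (slice X (<⇒≤ (<⇒≤ i<j)) j≤l))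
        v~u′ : at X l ~ at X 0
        v~u′ = subst₂ _~_ (≡-sym (at-end X)) (≡-sym (at-0 X)) v~u
        ring : Ring (at X) l
        ring = record { step = at-step X ; close = v~u′ ; distinct = distinct }
        finish : ∀ k → l ≡ k → ⊥
        finish 0 refl = ~⇒≢ v~u′ refl
        finish 1 refl = case even of λ ()
        finish 2 refl = no-triangle (at-step X z<s) (at-step X (s<s z<s)) v~u′
        finish (suc (suc (suc k))) refl with odd-hole⇒5 (ring⇒hole (s≤s (s≤s (s≤s z≤n))) ring chord) (even⇒suc-odd l even)
        ... | refl = no-pent (at X 0 , at X 1 , at X 2 , at X 3 , at X 4 ,
          pent (at-step X z<s) (at-step X (s<s z<s)) (at-step X (s<s (s<s z<s)))
            (at-step X (s<s (s<s (s<s z<s)))) v~u′ ,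
          at-P X 0 , at-P X 1 , at-P X 2 , at-P X 3 , at-P X 4)

  alternating⇒no-pent : ∀ {P χ} → Alternating P χ → ¬ PentIn P
  alternating⇒no-pent {χ = χ} alt (a , b , c , d , e , pent ab bc cd de ea , Pa , Pb , Pc , Pd , Pe) =
    p≢p⁻¹ (χ a) (trans (alt Pe Pa ea) (cong _⁻¹ e≡a))
    where
    c≡a = trans (alt Pb Pc bc) (trans (cong _⁻¹ (alt Pa Pb ab)) (⁻¹-involutive (χ a)))
    e≡a = trans (alt Pd Pe de) (trans (cong _⁻¹ (alt Pc Pd cd)) (trans (⁻¹-involutive (χ c)) c≡a))

  -- Gluing colourings along three consecutive vertices of a pentagon.

  module _ {a b c d e : Fin n} (C : Pent a b c d e) {S K : Fin n → Set} (K? : Decidable K)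
    (a∈S : S a) (b∈S : S b) (c∈S : S c) (a∉K : ¬ K a) (b∉K : ¬ K b) (c∉K : ¬ K c) (K⊆S : ∀ {x} → K x → S x)
    (boundary : ∀ {x y} → K x → S y → ¬ K y → x ~ y → y ≡ a ⊎ y ≡ b ⊎ y ≡ c) where

    -- The two sides cover `S` and overlap in `a`, `b`, `c`; by `boundary` each edge of `S` lies
    -- within one of them.
    S₁ S₂ : Fin n → Set
    S₁ x = K x ⊎ (x ≡ a ⊎ x ≡ b ⊎ x ≡ c)
    S₂ x = S x × ¬ K x

    S₁∖K⊆S₂ : ∀ {x} → S₁ x → ¬ K x → S₂ x
    S₁∖K⊆S₂ (inj₁ Kx)                 ¬Kx = ⊥-elim (¬Kx Kx)
    S₁∖K⊆S₂ (inj₂ (inj₁ refl))        ¬Kx = a∈S , ¬Kx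
    S₁∖K⊆S₂ (inj₂ (inj₂ (inj₁ refl))) ¬Kx = b∈S , ¬Kx
    S₁∖K⊆S₂ (inj₂ (inj₂ (inj₂ refl))) ¬Kx = c∈S , ¬Kx

    glue : ∀ {f g} → Proper S₁ f → Proper S₂ g → f a ≡ g a → f b ≡ g b → f c ≡ g c → Colourable S
    glue {f} {g} pf pg fa fb fc = merge K? f g , merge-proper K? f g
      (λ (_ , Ku) (_ , Kv) → pf (inj₁ Ku) (inj₁ Kv)) pg across
      where
      across : ∀ {u v} → S u → S v → K u → ¬ K v → u ~ v → f u ≢ g v
      across _ Sv Ku ¬Kv e eq with boundary Ku Sv ¬Kv e
      ... | inj₁ refl        = pf (inj₁ Ku) (inj₂ (inj₁ refl)) e (trans eq (≡-sym fa))
      ... | inj₂ (inj₁ refl) = pf (inj₁ Ku) (inj₂ (inj₂ (inj₁ refl))) e (trans eq (≡-sym fb))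
      ... | inj₂ (inj₂ refl) = pf (inj₁ Ku) (inj₂ (inj₂ (inj₂ refl))) e (trans eq (≡-sym fc))

    a∈S₁ : S₁ a
    a∈S₁ = inj₂ (inj₁ refl)

    b∈S₁ : S₁ b
    b∈S₁ = inj₂ (inj₂ (inj₁ refl))

    c∈S₁ : S₁ c
    c∈S₁ = inj₂ (inj₂ (inj₂ refl))


    module _ {f g : Fin n → Fin 3} (pf : Proper S₁ f) (pg : Proper S₂ g)
      (fa : f a ≡ 1F) (ga : g a ≡ 1F) (fb : f b ≡ 0F) (gb : g b ≡ 0F) where

      fc≢0 : f c ≢ 0F
      fc≢0 eq = pf b∈S₁ c∈S₁ (Pent.bc C) (trans fb (≡-sym eq))

      gc≢0 : g c ≢ 0F
      gc≢0 eq = pg (b∈S , b∉K) (c∈S , c∉K) (Pent.bc C) (trans gb (≡-sym eq))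

      -- The vertices open to Kempe chains in colours `1F` and `2F`, on each side and together.
      T₁ T₂ T : Fin n → Set
      T₁ x = S₁ x × f x ≢ 0F
      T₂ x = S₂ x × g x ≢ 0F
      T x = T₁ x ⊎ T₂ x

      T-b : ∀ {x} → T x → x ≢ b
      T-b (inj₁ (_ , fx)) refl = fx fb
      T-b (inj₂ (_ , gx)) refl = gx gb

      T∩K : ∀ {x} → T x → K x → T₁ x
      T∩K (inj₁ t)              Kx = t
      T∩K (inj₂ ((_ , ¬Kx) , _)) Kx = ⊥-elim (¬Kx Kx)

      T∖K : ∀ {x} → T x → ¬ K x → T₂ x
      T∖K (inj₂ t) _ = t
      T∖K (inj₁ (inj₁ Kx , _)) ¬Kx = ⊥-elim (¬Kx Kx)
      T∖K (inj₁ (inj₂ (inj₁ refl) , _)) ¬Kx = (a∈S , a∉K) , λ eq → case trans (≡-sym ga) eq of λ ()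
      T∖K (inj₁ (inj₂ (inj₂ (inj₁ refl)) , fx)) ¬Kx = ⊥-elim (fx fb)
      T∖K (inj₁ (inj₂ (inj₂ (inj₂ refl)) , _)) ¬Kx = (c∈S , c∉K) , gc≢0

      -- merge K? f h avoids colour 0 on T and can fail to be proper there only at a vertex among a and c on
      -- which f and h disagree, so a pentagon in T must contain such a vertex.
      pent-meets : (h : Fin n → Fin 3) → Proper S₂ h → (∀ {x} → g x ≢ 0F → h x ≢ 0F) →
        (Q : Fin n → Set) → (∀ {x} → Q x → T x) → (Q a → f a ≡ h a) → (Q c → f c ≡ h c) → ¬ PentIn Q
      pent-meets h ph h≢0 Q Q⊆T ha hc =
        alternating⇒no-pent (proper⇒alternating proper nonzero)
        where
        k = merge K? f h
        proper : Proper Q k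
        proper = merge-proper K? f h
          (λ (_ , Ku) (_ , Kv) → pf (inj₁ Ku) (inj₁ Kv))
          (λ (Qu , ¬Ku) (Qv , ¬Kv) → ph (proj₁ (T∖K (Q⊆T Qu) ¬Ku)) (proj₁ (T∖K (Q⊆T Qv) ¬Kv)))
          across
          where
          across : ∀ {u v} → Q u → Q v → K u → ¬ K v → u ~ v → f u ≢ h v
          across _ Qv Ku ¬Kv e eq with boundary Ku (proj₁ (proj₁ (T∖K (Q⊆T Qv) ¬Kv))) ¬Kv e
          ... | inj₁ refl        = pf (inj₁ Ku) a∈S₁ e (trans eq (≡-sym (ha Qv)))
          ... | inj₂ (inj₁ refl) = T-b (Q⊆T Qv) refl
          ... | inj₂ (inj₂ refl) = pf (inj₁ Ku) c∈S₁ e (trans eq (≡-sym (hc Qv)))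
        nonzero : ∀ {x} → Q x → k x ≢ 0F
        nonzero {x} Qx with K? x
        ... | yes Kx = proj₂ (T∩K (Q⊆T Qx) Kx)
        ... | no ¬Kx = h≢0 (proj₂ (T∖K (Q⊆T Qx) ¬Kx))

      module _ (fc≢gc : f c ≢ g c) where

        -- If the pentagon contains `a`, then `a` and `c` are adjacent or, with `b`, lie on a
        -- 4-cycle. If not, take `h = swap ∘ g`, which agrees with `f` at `c`.
        pent-at-c : ∀ {v₂ v₃ v₄ v₅} → Pent c v₂ v₃ v₄ v₅ → T c → T v₂ → T v₃ → T v₄ → ¬ T v₅
        pent-at-c {v₂} {v₃} {v₄} {v₅} P t₁ t₂ t₃ t₄ t₅ with v₂ ≟ a | v₃ ≟ a | v₄ ≟ a | v₅ ≟ a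
        ... | yes refl | _ | _ | _ = a≁c C (~-sym (Pent.ab P))
        ... | _ | yes refl | _ | _ = no-square (Pent.ab C) (Pent.bc C) (Pent.ab P) (Pent.bc P) (a≢c C) (≢-sym (T-b t₂))
        ... | _ | _ | yes refl | _ =
          no-square (Pent.ab C) (Pent.bc C) (~-sym (Pent.ea P)) (~-sym (Pent.de P)) (a≢c C) (≢-sym (T-b t₅))
        ... | _ | _ | _ | yes refl = a≁c C (Pent.ea P)
        ... | no n₂ | no n₃ | no n₄ | no n₅ = pent-meets (swap ∘ g)
          (λ Su Sv e → swap-injective (pg Su Sv e)) swap-injective
          (λ x → T x × x ≢ a) proj₁ (λ (_ , a≢a) → ⊥-elim (a≢a refl))
          (λ _ → ≡-sym (swap-other gc≢0 fc≢0 (≢-sym fc≢gc)))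
          (_ , _ , _ , _ , _ , P , (t₁ , ≢-sym (a≢c C)) , (t₂ , n₂) , (t₃ , n₃) , (t₄ , n₄) , (t₅ , n₅))

        -- For a pentagon avoiding `c` take `h = g`, which agrees with `f` at `a`.
        no-pent-in-T : ¬ PentIn T
        no-pent-in-T (v₁ , v₂ , v₃ , v₄ , v₅ , P , t₁ , t₂ , t₃ , t₄ , t₅)
          with v₁ ≟ c | v₂ ≟ c | v₃ ≟ c | v₄ ≟ c | v₅ ≟ c
        ... | yes refl | _ | _ | _ | _ = pent-at-c P t₁ t₂ t₃ t₄ t₅
        ... | _ | yes refl | _ | _ | _ = pent-at-c (rot P) t₂ t₃ t₄ t₅ t₁
        ... | _ | _ | yes refl | _ | _ = pent-at-c (rot (rot P)) t₃ t₄ t₅ t₁ t₂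
        ... | _ | _ | _ | yes refl | _ = pent-at-c (rot (rot (rot P))) t₄ t₅ t₁ t₂ t₃
        ... | _ | _ | _ | _ | yes refl = pent-at-c (rot⁻¹ P) t₅ t₁ t₂ t₃ t₄
        ... | no n₁ | no n₂ | no n₃ | no n₄ | no n₅ = pent-meets g pg (λ g≢0 → g≢0)
          (λ x → T x × x ≢ c) proj₁ (λ _ → trans fa (≡-sym ga)) (λ (_ , c≢c) → ⊥-elim (c≢c refl))
          (_ , _ , _ , _ , _ , P , (t₁ , n₁) , (t₂ , n₂) , (t₃ , n₃) , (t₄ , n₄) , (t₅ , n₅))

        -- As `f c` and `g c` differ while `f a` and `g a` agree, the chains have lengths of
        -- opposite parity and form an odd closed walk in `T`.
        no-two-chains : Reach T₁ c a → ¬ Reach T₂ c a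
        no-two-chains (l , X) (m , Y) = closed-walk (map inj₁ X ++ map inj₂ (reverse Y)) odd
          where
          closed-walk : ∀ {k} → Walk T c c k → ¬ parity k ≡ 1ℙ
          closed-walk [ _ ] ()
          closed-walk (_⟨_⟩_ {l = k} _ e Z) odd =
            no-odd-closed-walk no-pent-in-T k (⁻¹-injective (trans (≡-sym (parity-suc k)) odd)) e Z
          length-parity : ∀ {P h k} → Proper P h → Walk (λ x → P x × h x ≢ 0F) c a k → h a ≡ 1F → parity k ≡ side (h c)
          length-parity {P} {h} {k} ph X ha = ℙₚ.+-cancelʳ-≡ (side (h c)) _ _
            (trans (≡-sym (walk-parity {χ = side ∘ h}
              (proper⇒alternating (λ (Pu , _) (Pv , _) → ph Pu Pv) proj₂) X))
            (trans (cong side ha) (≡-sym (ℙₚ.p+p≡0ℙ (side (h c))))))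
          odd : parity (l + m) ≡ 1ℙ
          odd = begin
            parity (l + m)                    ≡⟨ +-homo-+ l m ⟩
            parity l ℙ.+ parity m             ≡⟨ cong (ℙ._+ parity m) (length-parity pf X fa) ⟩
            side (f c) ℙ.+ parity m           ≡⟨ cong (side (f c) ℙ.+_) (length-parity pg Y ga) ⟩
            side (f c) ℙ.+ side (g c)         ≡⟨ cong (side (f c) ℙ.+_) (side-other fc≢0 gc≢0 fc≢gc) ⟩
            side (f c) ℙ.+ (side (f c) ⁻¹)    ≡⟨ ℙₚ.p+p⁻¹≡1ℙ (side (f c)) ⟩
            1ℙ                                ∎
            where open ≡-Reasoning

        -- On some side the Kempe component of `c` misses `a`, and it misses `b` because of its
        -- colour. The swap there changes neither, and gives `c` its colour on the other side.
        glue-after-swap : ¬ ¬ Colourable S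
        glue-after-swap uncolourable = ¬¬-decidable (Reach T₁ c) λ W₁? → ¬¬-decidable (Reach T₂ c) λ W₂? →
          cases W₁? W₂? (W₁? a) (W₂? a)
          where
          cases : Decidable (Reach T₁ c) → Decidable (Reach T₂ c) → Dec (Reach T₁ c a) → Dec (Reach T₂ c a) → ⊥
          cases W₁? W₂? (yes X) (yes Y) = no-two-chains X Y
          cases W₁? W₂? (no ¬X) _ = uncolourable (glue (KempeSwap.kempe-proper pf c W₁?) pg
            (trans (merge-out W₁? (swap ∘ f) f ¬X) (trans fa (≡-sym ga)))
            (trans (merge-out W₁? (swap ∘ f) f (λ (_ , X) → proj₂ (end X) fb)) (trans fb (≡-sym gb)))
            (trans (merge-in W₁? (swap ∘ f) f (0 , [ c∈S₁ , fc≢0 ])) (swap-other fc≢0 gc≢0 fc≢gc)))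
          cases W₁? W₂? _ (no ¬Y) = uncolourable (glue pf (KempeSwap.kempe-proper pg c W₂?)
            (≡-sym (trans (merge-out W₂? (swap ∘ g) g ¬Y) (trans ga (≡-sym fa))))
            (≡-sym (trans (merge-out W₂? (swap ∘ g) g (λ (_ , Y) → proj₂ (end Y) gb)) (trans gb (≡-sym fb))))
            (≡-sym (trans (merge-in W₂? (swap ∘ g) g (0 , [ (c∈S , c∉K) , gc≢0 ]))
              (swap-other gc≢0 fc≢0 (≢-sym fc≢gc)))))

    P₃-gluing : Colourable S₁ → Colourable S₂ → ¬ ¬ Colourable S
    P₃-gluing (f , pf) (g , pg) uncolourable
      with normalise (f b) (f a) (pf b∈S₁ a∈S₁ (~-sym (Pent.ab C)))
         | normalise (g b) (g a) (pg (b∈S , b∉K) (a∈S , a∉K) (~-sym (Pent.ab C)))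
    ... | π , π-inj , πfb , πfa | ρ , ρ-inj , ρgb , ρga with π (f c) ≟ ρ (g c)
    ... | yes eq = uncolourable (glue (λ Su Sv e → π-inj (pf Su Sv e)) (λ Su Sv e → ρ-inj (pg Su Sv e))
      (trans πfa (≡-sym ρga)) (trans πfb (≡-sym ρgb)) eq)
    ... | no neq = glue-after-swap (λ Su Sv e → π-inj (pf Su Sv e)) (λ Su Sv e → ρ-inj (pg Su Sv e))
      πfa ρga πfb ρgb neq uncolourable

  -- Sets contained in a pentagon.

  locate : ∀ a b c d e x → Off a b c d e x ⊎ (x ≡ a ⊎ x ≡ b ⊎ x ≡ c ⊎ x ≡ d ⊎ x ≡ e)
  locate a b c d e x with a ≟ x | b ≟ x | c ≟ x | d ≟ x | e ≟ x
  ... | yes refl | _ | _ | _ | _ = inj₂ (inj₁ refl)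
  ... | _ | yes refl | _ | _ | _ = inj₂ (inj₂ (inj₁ refl))
  ... | _ | _ | yes refl | _ | _ = inj₂ (inj₂ (inj₂ (inj₁ refl)))
  ... | _ | _ | _ | yes refl | _ = inj₂ (inj₂ (inj₂ (inj₂ (inj₁ refl))))
  ... | _ | _ | _ | _ | yes refl = inj₂ (inj₂ (inj₂ (inj₂ (inj₂ refl))))
  ... | no p | no q | no r | no s | no t = inj₁ (off p q r s t)

  off? : ∀ a b c d e → Decidable (Off a b c d e)
  off? a b c d e x = map′ (λ (p , q , r , s , t) → off p q r s t) (λ (off p q r s t) → p , q , r , s , t)
    (¬? (a ≟ x) ×-dec ¬? (b ≟ x) ×-dec ¬? (c ≟ x) ×-dec ¬? (d ≟ x) ×-dec ¬? (e ≟ x))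

  -- Give `e` colour `2F`, the non-adjacent `a` and `c` colour `0F`, and the non-adjacent `b` and
  -- `d` colour `1F`.
  pent-colourable : ∀ {a b c d e S} → Pent a b c d e → (∀ {x} → S x → ¬ Off a b c d e x) → Colourable S
  pent-colourable {a} {b} {c} {d} {e} {S} C on =
    merge e? (λ _ → 2F) rest , merge-proper e? (λ _ → 2F) rest
      (λ { (_ , refl) (_ , refl) e~e → ⊥-elim (irrefl G e~e) })
      (merge-proper ac? (λ _ → 0F) (λ _ → 1F) (λ (_ , x) (_ , y) → ⊥-elim ∘ ac-stable x y)
        (λ ((Sx , x≢e) , x∉ac) ((Sy , y≢e) , y∉ac) → ⊥-elim ∘ bd-stable (bd Sx x≢e x∉ac) (bd Sy y≢e y∉ac))
        (λ _ _ _ _ _ ()))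
      (λ {u} {v} _ _ _ _ _ → 2≢rest v)
    where
    e? : Decidable (_≡ e)
    e? = _≟ e
    ac? : Decidable (λ x → x ≡ a ⊎ x ≡ c)
    ac? x = x ≟ a ⊎-dec x ≟ c
    rest : Fin n → Fin 3
    rest = merge ac? (λ _ → 0F) (λ _ → 1F)
    2≢rest : ∀ v → 2F ≢ rest v
    2≢rest v with does (ac? v)
    ... | true  = λ ()
    ... | false = λ ()
    bd : ∀ {x} → S x → ¬ x ≡ e → ¬ (x ≡ a ⊎ x ≡ c) → x ≡ b ⊎ x ≡ d
    bd {x} Sx x≢e x∉ac with locate a b c d e x
    ... | inj₁ o = ⊥-elim (on Sx o)
    ... | inj₂ (inj₁ x≡a) = ⊥-elim (x∉ac (inj₁ x≡a))
    ... | inj₂ (inj₂ (inj₁ x≡b)) = inj₁ x≡b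
    ... | inj₂ (inj₂ (inj₂ (inj₁ x≡c))) = ⊥-elim (x∉ac (inj₂ x≡c))
    ... | inj₂ (inj₂ (inj₂ (inj₂ (inj₁ x≡d)))) = inj₂ x≡d
    ... | inj₂ (inj₂ (inj₂ (inj₂ (inj₂ x≡e)))) = ⊥-elim (x≢e x≡e)
    pair-stable : ∀ {p q} → ¬ p ~ q → ∀ {x y} → x ≡ p ⊎ x ≡ q → y ≡ p ⊎ y ≡ q → ¬ x ~ y
    pair-stable p≁q (inj₁ refl) (inj₁ refl) = irrefl G
    pair-stable p≁q (inj₁ refl) (inj₂ refl) = p≁q
    pair-stable p≁q (inj₂ refl) (inj₁ refl) = p≁q ∘ ~-sym
    pair-stable p≁q (inj₂ refl) (inj₂ refl) = irrefl G
    ac-stable = pair-stable (a≁c C)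
    bd-stable = pair-stable (a≁c (rot C))

  -- A minimal uncolourable set contains no pentagon and then no vertex.

  module _ {S : Fin n → Set} (S? : Decidable S)
    (ih : ∀ {T} → Decidable T → (∀ {x} → T x → S x) → (∃ λ x → S x × ¬ T x) → ¬ ¬ Colourable T)
    (uncolourable : ¬ Colourable S) where

    module _ {P : Fin n → Set} (P⊆S : ∀ {x} → P x → S x) {k : Fin n} (Pk : P k) (K? : Decidable (Reach P k)) where

      private
        K : Fin n → Set
        K = Reach P k

        K⊆P : ∀ {x} → K x → P x
        K⊆P (_ , X) = end X

        connect : ∀ {x y} → K x → K y → Reach P x y
        connect (_ , X) (_ , Y) = _ , reverse X ++ Y

        Missed : Fin n → Set
        Missed z = ∀ {x} → K x → ¬ z ~ x

      -- `P` is the part of `S` off the pentagon. It is tied to it by fields rather than by a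
      -- definition, so that `P` and its component `K` stay the same under rotation and reflection.
      record Around (a b c d e : Fin n) : Set where
        constructor around
        field
          is-pent : Pent a b c d e
          in-S    : S a × S b × S c × S d × S e
          P-off   : ∀ {x} → P x → Off a b c d e x
          off-P   : ∀ {x} → S x → Off a b c d e x → P x
      open Around

      around-rot : ∀ {a b c d e} → Around a b c d e → Around b c d e a
      around-rot (around C (p , q , r , s , t) f g) =
        around (rot C) (q , r , s , t , p) (off-rot ∘ f) (λ Sx → g Sx ∘ off-rot⁻¹)

      around-rot⁻¹ : ∀ {a b c d e} → Around a b c d e → Around e a b c d
      around-rot⁻¹ (around C (p , q , r , s , t) f g) =
        around (rot⁻¹ C) (t , p , q , r , s) (off-rot⁻¹ ∘ f) (λ Sx → g Sx ∘ off-rot)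

      around-flip : ∀ {a b c d e} → Around a b c d e → Around a e d c b
      around-flip (around C (p , q , r , s , t) f g) =
        around (flip C) (p , t , s , r , q) (off-flip ∘ f) (λ Sx → g Sx ∘ off-flip)

      -- Otherwise `a`, `b`, `c` separate `K` from the rest. Both sides are proper subsets, one
      -- lacking `d` and the other `k`, so `ih` colours them and `P₃-gluing` colours `S`.
      not-both-missed : ∀ {a b c d e} → Around a b c d e → Missed d → ¬ Missed e
      not-both-missed {a} {b} {c} {d} {e} (around C (a∈S , b∈S , c∈S , d∈S , e∈S) f g) miss-d miss-e =
        ih S₁? S₁⊆S (d , d∈S , d∉S₁) λ col₁ →
        ih (λ x → S? x ×-dec ¬? (K? x)) proj₁ (k , P⊆S Pk , λ (_ , k∉K) → k∉K (0 , [ Pk ])) λ col₂ →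
        P₃-gluing C K? a∈S b∈S c∈S (λ Ka → Off.a≢ (f (K⊆P Ka)) refl) (λ Kb → Off.b≢ (f (K⊆P Kb)) refl)
          (λ Kc → Off.c≢ (f (K⊆P Kc)) refl) (P⊆S ∘ K⊆P) boundary col₁ col₂ uncolourable
        where
        Kabc : Fin n → Set
        Kabc x = K x ⊎ (x ≡ a ⊎ x ≡ b ⊎ x ≡ c)
        S₁? : Decidable Kabc
        S₁? x = K? x ⊎-dec (x ≟ a ⊎-dec (x ≟ b ⊎-dec x ≟ c))
        S₁⊆S : ∀ {x} → Kabc x → S x
        S₁⊆S (inj₁ Kx) = P⊆S (K⊆P Kx)
        S₁⊆S (inj₂ (inj₁ refl)) = a∈S
        S₁⊆S (inj₂ (inj₂ (inj₁ refl))) = b∈S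
        S₁⊆S (inj₂ (inj₂ (inj₂ refl))) = c∈S
        d∉S₁ : ¬ Kabc d
        d∉S₁ (inj₁ Kd) = Off.d≢ (f (K⊆P Kd)) refl
        d∉S₁ (inj₂ (inj₁ d≡a)) = a≢c (rot (rot (rot C))) d≡a
        d∉S₁ (inj₂ (inj₂ (inj₁ d≡b))) = a≢c (rot C) (≡-sym d≡b)
        d∉S₁ (inj₂ (inj₂ (inj₂ d≡c))) = ~⇒≢ (Pent.cd C) (≡-sym d≡c)
        boundary : ∀ {x y} → K x → S y → ¬ K y → x ~ y → y ≡ a ⊎ y ≡ b ⊎ y ≡ c
        boundary {x} {y} Kx Sy ¬Ky x~y with locate a b c d e y
        ... | inj₁ o = ⊥-elim (¬Ky (_ , snoc (proj₂ Kx) x~y (g Sy o)))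
        ... | inj₂ (inj₁ y≡a) = inj₁ y≡a
        ... | inj₂ (inj₂ (inj₁ y≡b)) = inj₂ (inj₁ y≡b)
        ... | inj₂ (inj₂ (inj₂ (inj₁ y≡c))) = inj₂ (inj₂ y≡c)
        ... | inj₂ (inj₂ (inj₂ (inj₂ (inj₁ refl)))) = ⊥-elim (miss-d Kx (~-sym x~y))
        ... | inj₂ (inj₂ (inj₂ (inj₂ (inj₂ refl)))) = ⊥-elim (miss-e Kx (~-sym x~y))

      -- If `K` attaches to both `a` and `c`, then by `attached-within-P₃` it misses `d` and `e`.
      attached-misses : ∀ {a b c d e} → Around a b c d e → ∀ {u} → K u → a ~ u → Missed c
      attached-misses A Ku au {v} Kv cv = not-both-missed A
        (λ Kz dz → attached-within-P₃ (is-pent A) (P-off A) au cv (inj₁ dz) (proj₂ (connect Ku Kv)) (proj₂ (connect Ku Kz)))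
        (λ Kz ez → attached-within-P₃ (is-pent A) (P-off A) au cv (inj₂ ez) (proj₂ (connect Ku Kv)) (proj₂ (connect Ku Kz)))

      -- Attachment to `a` would make `K` miss `c` and, by reflection, `d`; these are consecutive.
      all-missed : ∀ {a b c d e} → Around a b c d e → Missed a
      all-missed A Ku au = not-both-missed (around-rot⁻¹ A) (attached-misses A Ku au)
        (attached-misses (around-flip A) Ku au)

      not-around : ∀ {a b c d e} → ¬ Around a b c d e
      not-around A = not-both-missed A
        (all-missed (around-rot (around-rot (around-rot A)))) (all-missed (around-rot⁻¹ A))

    no-pent : ¬ PentIn S
    no-pent (a , b , c , d , e , C , a∈S , b∈S , c∈S , d∈S , e∈S)
      with any? (λ k → S? k ×-dec off? a b c d e k)
    ... | no none = uncolourable (pent-colourable C (λ Sx o → none (_ , Sx , o)))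
    ... | yes (k , Sk , o) = ¬¬-decidable (Reach P k) λ K? →
      not-around proj₁ (Sk , o) K? (around C (a∈S , b∈S , c∈S , d∈S , e∈S) proj₂ _,_)
      where
      P : Fin n → Set
      P x = S x × Off a b c d e x

    -- The component of `k` is bipartite by the parity of walks from `k`, as an edge within a class
    -- would close an odd walk. The rest of `S` is colourable by `ih`, and no edge joins the two.
    no-vertex : ∀ {k} → ¬ S k
    no-vertex {k} Sk = ¬¬-decidable (Reach S k) λ K? → ¬¬-decidable EvenWalk λ E? →
      ih (λ x → S? x ×-dec ¬? (K? x)) proj₁ (k , Sk , λ (_ , k∉K) → k∉K (0 , [ Sk ])) λ (g , pg) →
      let f = merge E? (λ _ → 0F) (λ _ → 1F) in
      uncolourable (merge K? f g , merge-proper K? f g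
        (λ (_ , Ku) (_ , Kv) → merge-proper E? (λ _ → 0F) (λ _ → 1F)
          (λ (_ , X) (_ , Y) u~v eq → even-stable X Y u~v)
          (λ (Ku , ¬Eu) (Kv , ¬Ev) u~v eq → odd-stable (odd Ku ¬Eu) (odd Kv ¬Ev) u~v)
          (λ _ _ _ _ _ ()) Ku Kv)
        pg
        (λ _ Sv (_ , X) ¬Kv u~v _ → ¬Kv (_ , snoc X u~v Sv)))
      where
      EvenWalk OddWalk : Fin n → Set
      EvenWalk x = ∃ λ l → parity l ≡ 0ℙ × Walk S k x l
      OddWalk x = ∃ λ l → parity l ≡ 1ℙ × Walk S k x l
      odd : ∀ {x} → Reach S k x → ¬ EvenWalk x → OddWalk x
      odd (l , X) ¬Ex with parity l in eq
      ... | 0ℙ = ⊥-elim (¬Ex (l , eq , X))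
      ... | 1ℙ = l , eq , X
      even-stable : ∀ {u v} → EvenWalk u → EvenWalk v → ¬ u ~ v
      even-stable (l , el , X) (m , em , Y) u~v = no-odd-closed-walk no-pent (l + m)
        (trans (+-homo-+ l m) (cong₂ ℙ._+_ el em)) (~-sym u~v) (reverse X ++ Y)
      odd-stable : ∀ {u v} → OddWalk u → OddWalk v → ¬ u ~ v
      odd-stable (l , el , X) (m , em , Y) u~v = no-odd-closed-walk no-pent (l + m)
        (trans (+-homo-+ l m) (cong₂ ℙ._+_ el em)) (~-sym u~v) (reverse X ++ Y)

  -- Induction on strict inclusion, and removal of the double negation.

  subset-colourable : ∀ {p : Subset n} → Acc _⊂_ p → ¬ ¬ Colourable (_∈ p)
  subset-colourable {p} (acc rs) uncolourable =
    -- An uncolourable set would be empty, and then the constant colouring is vacuously proper.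
    uncolourable ((λ _ → 0F) , λ u∈p _ _ _ → no-vertex (_∈? p) ih uncolourable u∈p)
    where
    ih : ∀ {T} → Decidable T → (∀ {x} → T x → x ∈ p) → (∃ λ x → x ∈ p × ¬ T x) → ¬ ¬ Colourable T
    ih T? T⊆p (x , x∈p , ¬Tx) h = subset-colourable
      (rs ((λ y∈ → T⊆p (∈-subset⁻ T? y∈)) , x , x∈p , λ x∈ → ¬Tx (∈-subset⁻ T? x∈)))
      (λ (f , pf) → h (f , λ Tu Tv → pf (∈-subset⁺ T? Tu) (∈-subset⁺ T? Tv)))

-- The `3 ^ n` colourings are enumerated through their codes in `Fin (3 ^ n)`.
threeColorable? : ∀ {n} (G : Graph n) → Dec (ThreeColorable G)
threeColorable? {n} G = map′ (λ (i , proper) → finToFun i , proper)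
  (λ (f , proper) → funToFin f , λ u v u~v eq → proper u v u~v
    (trans (≡-sym (finToFun-funToFin f u)) (trans eq (finToFun-funToFin f v))))
  (any? λ (i : Fin (3 ^ n)) → all? λ u → all? λ v → dec G u v →-dec ¬? (finToFun i u ≟ finToFun i v))

theorem1p4 : ∀ {n : ℕ} (G : Graph n) → InG₂ G
    → (∀ (C D : Cycle G 5) → ¬ (Distinct5 C D × ShareEdge C D))
    → ThreeColorable G
theorem1p4 G G∈G₂ edge-disjoint = decidable-stable (threeColorable? G) λ ¬3col →
  EdgeDisjointPentagons.subset-colourable G G∈G₂ edge-disjoint (⊂-wellFounded ⊤)
    λ (f , proper) → ¬3col (f , λ _ _ → proper ∈⊤ ∈⊤)
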